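{- There exist infinitely many (pairwise non-isomorphic) $3$-connected $1$-plane graphs that have no connected spanning plane subgraphs.
   Context: All graphs are finite, simple and undirected. A (plane) drawing of a graph represents the vertices by distinct points of the plane and the edges by non-self-intersecting arcs joining the points of their end vertices and containing no vertex point in their interior. A $1$-plane graph is a graph given together with a plane drawing in which each edge is crossed at most once by another edge, i.e. each edge has at most one crossing point; crossings of adjacent edges are forbidden. A spanning plane subgraph of a $1$-plane graph $G$ is a subgraph $F$ with $V(F)=V(G)$ that is a plane graph with respect to the given drawing of $G$, i.e. no two edges of $F$ cross in that drawing. The connectivity is $\kappa(G)=\min\{p(u,v) : u,v\in V(G), u\neq v\}$, where $p(u,v)$ is the maximum number of pairwise internally vertex-disjoint $uv$-paths; $G$ is $k$-connected if $\kappa(G)\ge k$. -}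

module Defs where

open import Data.Bool.Base using (Bool; false; T)
open import Data.Fin.Base using (Fin) renaming (_<_ to _<ᶠ_)
open import Data.List.Base using (List; _∷_; _++_; [_])
open import Data.List.Relation.Binary.Disjoint.Propositional using (Disjoint)
open import Data.List.Relation.Unary.Linked using (Linked)
open import Data.List.Relation.Unary.Unique.Propositional using (Unique)
open import Data.Nat.Base as ℕ using (ℕ)
open import Data.Product.Base using (Σ-syntax; ∃-syntax; _×_; _,_; proj₁)
open import Data.Rational.Base using (ℚ; 0ℚ; 1ℚ; _+_; _-_; ∣_∣; _<_; _≤_)
open import Data.Rational.Properties using (+-inverseʳ)
open import Data.Sum.Base using (_⊎_)
open import Function.Bundles using (_⇔_; _↔_; Inverse)
open import Relation.Binary.PropositionalEquality using (_≡_; _≢_; sym; subst; cong)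
open import Relation.Nullary.Negation using (¬_)

------------------------------------------------------------------------
-- Real numbers

Eventually : (ℕ → Set) → Set
Eventually P = ∃[ N ] (∀ n → N ℕ.≤ n → P n)

record ℝ : Set where
  field
    seq    : ℕ → ℚ
    cauchy : ∀ ε → 0ℚ < ε →
             ∃[ N ] (∀ m n → N ℕ.≤ m → N ℕ.≤ n → ∣ seq m - seq n ∣ < ε)

open ℝ public

fromℚ : ℚ → ℝ
fromℚ q .seq _ = q
fromℚ q .cauchy ε 0<ε =
  0 , λ _ _ _ _ → subst (_< ε) (sym (cong ∣_∣ (+-inverseʳ q))) 0<ε

0ℝ 1ℝ : ℝ
0ℝ = fromℚ 0ℚ
1ℝ = fromℚ 1ℚ

infix 4 _<ʳ_ _≤ʳ_ _≈ʳ_ _≈ᵖ_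

_<ʳ_ : ℝ → ℝ → Set
x <ʳ y = ∃[ ε ] (0ℚ < ε × Eventually (λ n → seq x n + ε ≤ seq y n))

_≤ʳ_ : ℝ → ℝ → Set
x ≤ʳ y = ¬ (y <ʳ x)

-- |x - y| < ε
Near : ℚ → ℝ → ℝ → Set
Near ε x y = ∃[ η ] (η < ε × Eventually (λ n → ∣ seq x n - seq y n ∣ ≤ η))

_≈ʳ_ : ℝ → ℝ → Set
x ≈ʳ y = ∀ ε → 0ℚ < ε → Near ε x y

------------------------------------------------------------------------
-- The plane (with the maximum metric) and arcs in it

Point : Set
Point = ℝ × ℝ

_≈ᵖ_ : Point → Point → Set
(x , y) ≈ᵖ (x′ , y′) = x ≈ʳ x′ × y ≈ʳ y′

Nearᵖ : ℚ → Point → Point → Set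
Nearᵖ ε (x , y) (x′ , y′) = Near ε x x′ × Near ε y y′

I : Set
I = Σ[ t ∈ ℝ ] (0ℝ ≤ʳ t × t ≤ʳ 1ℝ)

-- Continuity implies compatibility with the setoid equalities, so this
-- need not be required separately of functions on ℝ, I or Point.
Continuous : {A B : Set} → (ℚ → A → A → Set) → (ℚ → B → B → Set) → (A → B) → Set
Continuous nearA nearB f =
  ∀ a ε → 0ℚ < ε →
  ∃[ δ ] (0ℚ < δ × (∀ a′ → nearA δ a a′ → nearB ε (f a) (f a′)))

record Arc (p q : Point) : Set where
  field
    at         : I → Point
    continuous : Continuous (λ δ s t → Near δ (proj₁ s) (proj₁ t)) Nearᵖ at
    injective  : ∀ s t → at s ≈ᵖ at t → proj₁ s ≈ʳ proj₁ t
    start      : ∀ t → proj₁ t ≈ʳ 0ℝ → at t ≈ᵖ p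
    end        : ∀ t → proj₁ t ≈ʳ 1ℝ → at t ≈ᵖ q

OnArc : {p q : Point} → Arc p q → Point → Set
OnArc γ x = ∃[ t ] (Arc.at γ t ≈ᵖ x)

InInterior : {p q : Point} → Arc p q → Point → Set
InInterior γ x = ∃[ t ] (0ℝ <ʳ proj₁ t × proj₁ t <ʳ 1ℝ × Arc.at γ t ≈ᵖ x)

record Homeomorphism : Set where
  field
    to        : Point → Point
    from      : Point → Point
    to-cont   : Continuous Nearᵖ Nearᵖ to
    from-cont : Continuous Nearᵖ Nearᵖ from
    to-from   : ∀ x → to (from x) ≈ᵖ x
    from-to   : ∀ x → from (to x) ≈ᵖ x

-- A proper crossing, as opposed to a tangency: up to a homeomorphism of
-- the plane, near x the two arcs are the coordinate axes near the origin.
CrossAt : {p q p′ q′ : Point} → Arc p q → Arc p′ q′ → Point → Set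
CrossAt γ γ′ x =
  InInterior γ x × InInterior γ′ x ×
  (Σ[ h ∈ Homeomorphism ] (let open Homeomorphism h in
     to (0ℝ , 0ℝ) ≈ᵖ x ×
     (∀ a b → Near 1ℚ a 0ℝ → Near 1ℚ b 0ℝ →
        (OnArc γ  (to (a , b)) ⇔ b ≈ʳ 0ℝ) ×
        (OnArc γ′ (to (a , b)) ⇔ a ≈ʳ 0ℝ))))

------------------------------------------------------------------------
-- Finite simple graphs

record Graph (n : ℕ) : Set where
  field
    adj      : Fin n → Fin n → Bool
    adj-sym  : ∀ u v → adj u v ≡ adj v u
    loopless : ∀ v → adj v v ≡ false

  Adj : Fin n → Fin n → Set
  Adj u v = T (adj u v)

open Graph public using (Adj)

-- Each undirected edge is listed once, from its smaller to its larger end.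
record Edge {n : ℕ} (G : Graph n) : Set where
  constructor edge
  field
    src tgt  : Fin n
    src<tgt  : src <ᶠ tgt
    adjacent : Adj G src tgt

open Edge public

Incident : ∀ {n} {G : Graph n} → Fin n → Edge G → Set
Incident v e = v ≡ src e ⊎ v ≡ tgt e

Isomorphic : ∀ {m n} → Graph m → Graph n → Set
Isomorphic {m} {n} G H =
  Σ[ φ ∈ Fin m ↔ Fin n ]
    (∀ u v → Graph.adj G u v ≡ Graph.adj H (Inverse.to φ u) (Inverse.to φ v))

-- A path between distinct ends; simple makes u = v impossible.
record Path {n : ℕ} (G : Graph n) (u v : Fin n) : Set where
  field
    internal : List (Fin n)
    linked   : Linked (Adj G) (u ∷ internal ++ [ v ])
    simple   : Unique (u ∷ internal ++ [ v ])

open Path public using (internal)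

Connected : ∀ {n} → Graph n → Set
Connected G = ∀ u v → u ≢ v → Path G u v

-- k ≤ p(u,v).  The paths must also be distinct: a single edge has no
-- internal vertices, hence is internally disjoint from itself.
DisjointPaths : ∀ {n} → ℕ → Graph n → Fin n → Fin n → Set
DisjointPaths k G u v =
  Σ[ P ∈ (Fin k → Path G u v) ]
    (∀ i j → i ≢ j →
       internal (P i) ≢ internal (P j) × Disjoint (internal (P i)) (internal (P j)))

-- k ≤ κ(G); the minimum is over a nonempty set only if there are two vertices.
KConnected : ∀ {n} → ℕ → Graph n → Set
KConnected {n} k G = 2 ℕ.≤ n × (∀ u v → u ≢ v → DisjointPaths k G u v)

------------------------------------------------------------------------
-- Drawings

record Drawing {n : ℕ} (G : Graph n) : Set where
  field
    pos          : Fin n → Point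
    pos-distinct : ∀ u v → u ≢ v → ¬ (pos u ≈ᵖ pos v)
    arc          : (e : Edge G) → Arc (pos (src e)) (pos (tgt e))
    avoids       : ∀ e v → ¬ InInterior (arc e) (pos v)
    -- Edges do not touch without crossing.
    no-tangency  : ∀ e f → e ≢ f → ∀ x →
                   InInterior (arc e) x → InInterior (arc f) x →
                   CrossAt (arc e) (arc f) x

  CrossesAt : Edge G → Edge G → Point → Set
  CrossesAt e f x = e ≢ f × CrossAt (arc e) (arc f) x

  Crosses : Edge G → Edge G → Set
  Crosses e f = ∃[ x ] CrossesAt e f x

record Is1Plane {n : ℕ} {G : Graph n} (D : Drawing G) : Set where
  open Drawing D
  field
    crossed-once : ∀ e f g x y → CrossesAt e f x → CrossesAt e g y →
                   f ≡ g × x ≈ᵖ y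
    non-adjacent : ∀ e f → Crosses e f → ¬ (∃[ v ] (Incident v e × Incident v f))

record OnePlaneGraph : Set where
  field
    order   : ℕ
    graph   : Graph order
    drawing : Drawing graph
    1-plane : Is1Plane drawing

open OnePlaneGraph public using (graph; drawing)

_⊆ᵍ_ : ∀ {n} → Graph n → Graph n → Set
F ⊆ᵍ G = ∀ u v → Adj F u v → Adj G u v

include : ∀ {n} (F G : Graph n) → F ⊆ᵍ G → Edge F → Edge G
include F G F⊆G (edge u v u<v uv) = edge u v u<v (F⊆G u v uv)

IsPlane : ∀ {n} (F G : Graph n) → F ⊆ᵍ G → Drawing G → Set
IsPlane F G F⊆G D =
  ∀ e f → ¬ Drawing.Crosses D (include F G F⊆G e) (include F G F⊆G f)

HasConnectedSpanningPlaneSubgraph : OnePlaneGraph → Set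
HasConnectedSpanningPlaneSubgraph G =
  Σ[ F ∈ Graph (OnePlaneGraph.order G) ]
  Σ[ F⊆G ∈ F ⊆ᵍ graph G ]
    (IsPlane F (graph G) F⊆G (drawing G) × Connected F)

{-# OPTIONS --safe #-}
module Submission where

-- The hubs 0 and 1 are joined to all vertices 13, 14, … of the rim, a path that can be
-- arbitrarily long.  The other vertices 2, …, 12 are cubic, and the 20 edges at them fall into
-- ten pairs of crossing edges.  A plane subgraph contains at most ten of these edges, but
-- eleven are needed to connect the eleven vertices with each other and with the rest.
--
-- The drawing is straight-line with integer coordinates: a separating line shows that two edges
-- do not meet, and affine coordinates with the two edges as axes show that they cross.
-- Three disjoint paths between vertices up to 13 are explicit; paths to later vertices prolong
-- a fan along the rim.

open import Defs
open import Data.Fin.Permutation using (↔⇒≡)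
open import Data.Nat.Base as ℕ using (ℕ)
import Data.Nat.Properties as ℕ
open import Data.Product.Base using (Σ-syntax; _×_; _,_)
open import Relation.Binary.PropositionalEquality using (_≢_)
open import Relation.Nullary.Negation using (¬_)

-- The count succeeds because few edges leave the cubic vertices. If k cubic vertices send x edges
-- to the rest and all their edges fall into crossing pairs, there are (3k + x) / 4 pairs, which is
-- less than k exactly if x < k. Here k = 11 and x = 7 give 10.
--
-- The order of Cauchy reals is undecidable, so no step may compare two reals. All vertices have
-- integer coordinates, all decisions are taken in ℤ or ℚ, and a real parameter enters only through
-- rational slack: an interior parameter of an arc keeps a positive rational distance from 0 and 1,
-- which turns weak separation by a line into a positive rational gap between the two points.
--
-- Infinitely many spokes and rim edges are controlled by finite checks, because three lines through
-- vertex 13 have all edges at the cubic vertices on one side and the rim on the other.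
--
-- Connectedness is refuted by a function on the vertices that is constant along every edge of the
-- plane subgraph without being constant. Spokes and rim edges need no counting for this, as all
-- their ends have one colour from the outset.

-- Affine functions of Cauchy reals, order and equality.

module Reals where
  open import Data.Integer.Base using (+_)
  open import Data.Nat.Base as ℕ using (ℕ)
  import Data.Nat.Properties as ℕ
  open import Data.Product.Base using (_,_)
  open import Data.Sum.Base using (inj₁; inj₂)
  open import Data.Rational.Base
    using (ℚ; 0ℚ; 1ℚ; ½; _+_; _*_; _-_; -_; 1/_; ∣_∣; _<_; _≤_; Positive; positive; nonNegative)
  open import Data.Rational.Properties
  open import Data.Rational.Solver using (module +-*-Solver)
  open import Relation.Binary.PropositionalEquality
    using (_≡_; refl; sym; trans; cong; cong₂; subst; subst₂)
  open import Relation.Nullary.Negation using (¬_)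
  open +-*-Solver using (solve; _:=_; _:+_; _:*_; _:-_; :-_; con)

  both : ∀ {P Q R : ℕ → Set} → Eventually P → Eventually Q → (∀ n → P n → Q n → R n) → Eventually R
  both (M , p) (N , q) f =
    M ℕ.⊔ N , λ n n≥ → f n (p n (ℕ.m⊔n≤o⇒m≤o M N n≥)) (q n (ℕ.m⊔n≤o⇒n≤o M N n≥))

  always : ∀ {P : ℕ → Set} → (∀ n → P n) → Eventually P
  always p = 0 , λ n _ → p n

  0<* : ∀ {p q} → 0ℚ < p → 0ℚ < q → 0ℚ < p * q
  0<* {p} {q} 0<p 0<q =
    positive⁻¹ (p * q) {{pos*pos⇒pos p {{positive 0<p}} q {{positive 0<q}}}}

  *-mono-≤-nonNeg : ∀ {p q} r → 0ℚ ≤ r → p ≤ q → r * p ≤ r * q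
  *-mono-≤-nonNeg r 0≤r = *-monoˡ-≤-nonNeg r {{nonNegative 0≤r}}

  0≤* : ∀ {p q} → 0ℚ ≤ p → 0ℚ ≤ q → 0ℚ ≤ p * q
  0≤* {p} {q} 0≤p 0≤q = subst (_≤ p * q) (*-zeroʳ p) (*-mono-≤-nonNeg p 0≤p 0≤q)

  0≤q-p : ∀ {p q} → p ≤ q → 0ℚ ≤ q - p
  0≤q-p {p} {q} p≤q = subst (_≤ q - p) (+-inverseʳ p) (+-monoˡ-≤ (- p) p≤q)

  q-p≥0⇒p≤q : ∀ {p q} → 0ℚ ≤ q - p → p ≤ q
  q-p≥0⇒p≤q {p} {q} h =
    subst₂ _≤_ (+-identityˡ p) (solve 2 (λ p q → (q :- p) :+ p := q) refl p q) (+-monoˡ-≤ p h)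

  0<q-p : ∀ {p q} → p < q → 0ℚ < q - p
  0<q-p {p} {q} p<q = subst (_< q - p) (+-inverseʳ p) (+-monoˡ-< (- p) p<q)

  0≤+ : ∀ {p q} → 0ℚ ≤ p → 0ℚ ≤ q → 0ℚ ≤ p + q
  0≤+ = +-mono-≤

  -- A Lipschitz constant of (x , y) ↦ α x + β y, made positive by the summand 1.
  slope : ℚ → ℚ → ℚ
  slope α β = ∣ α ∣ + ∣ β ∣ + 1ℚ

  slope-pos : ∀ α β → Positive (slope α β)
  slope-pos α β =
    nonNeg+pos⇒pos (∣ α ∣ + ∣ β ∣)
      {{nonNegative (0≤+ (0≤∣p∣ α) (0≤∣p∣ β))}} 1ℚ

  slope⁻¹ : ℚ → ℚ → ℚ
  slope⁻¹ α β = (1/ slope α β) {{pos⇒nonZero (slope α β) {{slope-pos α β}}}}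

  shrink : ℚ → ℚ → ℚ → ℚ
  shrink α β ε = ε * slope⁻¹ α β

  shrink-pos : ∀ α β {ε} → 0ℚ < ε → 0ℚ < shrink α β ε
  shrink-pos α β 0<ε =
    0<* 0<ε (positive⁻¹ (slope⁻¹ α β) {{1/pos⇒pos (slope α β) {{slope-pos α β}}}})

  shrink-slope : ∀ α β ε → slope α β * shrink α β ε ≡ ε
  shrink-slope α β ε = begin-equality
    s * (ε * slope⁻¹ α β) ≡⟨ solve 3 (λ s e t → s :* (e :* t) := e :* (s :* t)) refl s ε (slope⁻¹ α β) ⟩
    ε * (s * slope⁻¹ α β) ≡⟨ cong (ε *_) (*-inverseʳ s {{pos⇒nonZero s {{slope-pos α β}}}}) ⟩
    ε * 1ℚ                ≡⟨ *-identityʳ ε ⟩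
    ε                     ∎
    where
    open ≤-Reasoning
    s = slope α β

  -- The summand 1 in `slope` leaves one spare `shrink α β ε`. This makes the inequality strict, as
  -- `Near` and the Cauchy condition demand, even for α = β = 0.
  shrink-slack : ∀ α β {ε} → 0ℚ < ε → (∣ α ∣ + ∣ β ∣) * shrink α β ε < ε
  shrink-slack α β {ε} 0<ε = begin-strict
    (∣ α ∣ + ∣ β ∣) * δ      ≡⟨ +-identityʳ _ ⟨
    (∣ α ∣ + ∣ β ∣) * δ + 0ℚ <⟨ +-monoʳ-< ((∣ α ∣ + ∣ β ∣) * δ) (shrink-pos α β 0<ε) ⟩
    (∣ α ∣ + ∣ β ∣) * δ + δ  ≡⟨ solve 2 (λ s d → s :* d :+ d := (s :+ con 1ℚ) :* d) refl (∣ α ∣ + ∣ β ∣) δ ⟩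
    slope α β * δ            ≡⟨ shrink-slope α β ε ⟩
    ε                        ∎
    where
    open ≤-Reasoning
    δ = shrink α β ε

  lin-bound : ∀ α β γ {x x′ y y′} δ → ∣ x - x′ ∣ ≤ δ → ∣ y - y′ ∣ ≤ δ →
              ∣ (α * x + β * y + γ) - (α * x′ + β * y′ + γ) ∣ ≤ (∣ α ∣ + ∣ β ∣) * δ
  lin-bound α β γ {x} {x′} {y} {y′} δ hx hy = begin
    ∣ (α * x + β * y + γ) - (α * x′ + β * y′ + γ) ∣
      ≡⟨ cong ∣_∣ (solve 7 (λ a b c x x′ y y′ →
           (a :* x :+ b :* y :+ c) :- (a :* x′ :+ b :* y′ :+ c) :=
           a :* (x :- x′) :+ b :* (y :- y′)) refl α β γ x x′ y y′) ⟩
    ∣ α * (x - x′) + β * (y - y′) ∣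
      ≤⟨ ∣p+q∣≤∣p∣+∣q∣ (α * (x - x′)) (β * (y - y′)) ⟩
    ∣ α * (x - x′) ∣ + ∣ β * (y - y′) ∣
      ≡⟨ cong₂ _+_ (∣p*q∣≡∣p∣*∣q∣ α (x - x′)) (∣p*q∣≡∣p∣*∣q∣ β (y - y′)) ⟩
    ∣ α ∣ * ∣ x - x′ ∣ + ∣ β ∣ * ∣ y - y′ ∣
      ≤⟨ +-mono-≤ (*-mono-≤-nonNeg ∣ α ∣ (0≤∣p∣ α) hx) (*-mono-≤-nonNeg ∣ β ∣ (0≤∣p∣ β) hy) ⟩
    ∣ α ∣ * δ + ∣ β ∣ * δ
      ≡⟨ *-distribʳ-+ δ ∣ α ∣ ∣ β ∣ ⟨
    (∣ α ∣ + ∣ β ∣) * δ ∎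
    where open ≤-Reasoning

  -- Segments, homeomorphisms and separating functionals are all built from this function, so
  -- continuity and compatibility with `≈ʳ` are proved only once.
  lin : ℚ → ℚ → ℚ → ℝ → ℝ → ℝ
  lin α β γ x y .seq n = α * seq x n + β * seq y n + γ
  lin α β γ x y .cauchy ε 0<ε =
    let M , p = cauchy x (shrink α β ε) (shrink-pos α β 0<ε)
        N , q = cauchy y (shrink α β ε) (shrink-pos α β 0<ε)
    in M ℕ.⊔ N , λ m n m≥ n≥ → ≤-<-trans
       (lin-bound α β γ (shrink α β ε)
         (<⇒≤ (p m n (ℕ.m⊔n≤o⇒m≤o M N m≥) (ℕ.m⊔n≤o⇒m≤o M N n≥)))
         (<⇒≤ (q m n (ℕ.m⊔n≤o⇒n≤o M N m≥) (ℕ.m⊔n≤o⇒n≤o M N n≥))))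
       (shrink-slack α β 0<ε)

  lin-near : ∀ α β γ {x x′ y y′ ε} → 0ℚ < ε →
             Near (shrink α β ε) x x′ → Near (shrink α β ε) y y′ →
             Near ε (lin α β γ x y) (lin α β γ x′ y′)
  lin-near α β γ {ε = ε} 0<ε (η₁ , η₁< , hx) (η₂ , η₂< , hy) =
    (∣ α ∣ + ∣ β ∣) * shrink α β ε , shrink-slack α β 0<ε , both hx hy λ n p q →
      lin-bound α β γ (shrink α β ε) (≤-trans p (<⇒≤ η₁<)) (≤-trans q (<⇒≤ η₂<))

  -- Reduces equality of affine expressions in reals to ring identities in ℚ, index by index.
  ≗⇒≈ : ∀ {x y} → (∀ n → seq x n ≡ seq y n) → x ≈ʳ y
  ≗⇒≈ {x} {y} x≗y ε 0<ε = 0ℚ , 0<ε , always λ n →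
    ≤-reflexive (cong ∣_∣ (trans (cong (_- seq y n) (x≗y n)) (+-inverseʳ (seq y n))))

  ≈-refl : ∀ {x} → x ≈ʳ x
  ≈-refl {x} = ≗⇒≈ {x} {x} λ _ → refl

  ∣p-q∣≡∣q-p∣ : ∀ p q → ∣ p - q ∣ ≡ ∣ q - p ∣
  ∣p-q∣≡∣q-p∣ p q = trans (cong ∣_∣ (solve 2 (λ p q → p :- q := :- (q :- p)) refl p q)) (∣-p∣≡∣p∣ (q - p))

  near-sym : ∀ {ε x y} → Near ε x y → Near ε y x
  near-sym {x = x} {y} (η , η<ε , N , h) =
    η , η<ε , N , λ n n≥ → subst (_≤ η) (∣p-q∣≡∣q-p∣ (seq x n) (seq y n)) (h n n≥)

  ≈-sym : ∀ {x y} → x ≈ʳ y → y ≈ʳ x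
  ≈-sym {x} {y} x≈y ε 0<ε = near-sym {ε} {x} {y} (x≈y ε 0<ε)

  near-trans : ∀ {δ ε x y z} → Near δ x y → Near ε y z → Near (δ + ε) x z
  near-trans {x = x} {y} {z} (η₁ , η₁<δ , hxy) (η₂ , η₂<ε , hyz) =
    η₁ + η₂ , +-mono-< η₁<δ η₂<ε , both hxy hyz λ n p q → begin
      ∣ seq x n - seq z n ∣
        ≡⟨ cong ∣_∣ (solve 3 (λ x y z → x :- z := (x :- y) :+ (y :- z)) refl (seq x n) (seq y n) (seq z n)) ⟩
      ∣ (seq x n - seq y n) + (seq y n - seq z n) ∣
        ≤⟨ ∣p+q∣≤∣p∣+∣q∣ (seq x n - seq y n) (seq y n - seq z n) ⟩
      ∣ seq x n - seq y n ∣ + ∣ seq y n - seq z n ∣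
        ≤⟨ +-mono-≤ p q ⟩
      η₁ + η₂ ∎
    where open ≤-Reasoning

  halves : ∀ ε → ½ * ε + ½ * ε ≡ ε
  halves = solve 1 (λ e → con ½ :* e :+ con ½ :* e := e) refl

  ≈-trans : ∀ {x y z} → x ≈ʳ y → y ≈ʳ z → x ≈ʳ z
  ≈-trans {x} {y} {z} x≈y y≈z ε 0<ε =
    subst (λ e → Near e x z) (halves ε)
      (near-trans {½ * ε} {½ * ε} {x} {y} {z} (x≈y _ 0<½ε) (y≈z _ 0<½ε))
    where
    0<½ε : 0ℚ < ½ * ε
    0<½ε = 0<* {½} (positive⁻¹ ½) 0<ε

  lin-cong : ∀ α β γ {x x′ y y′} → x ≈ʳ x′ → y ≈ʳ y′ → lin α β γ x y ≈ʳ lin α β γ x′ y′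
  lin-cong α β γ {x} {x′} {y} {y′} x≈ y≈ ε 0<ε =
    lin-near α β γ {x} {x′} {y} {y′} 0<ε (x≈ _ (shrink-pos α β 0<ε)) (y≈ _ (shrink-pos α β 0<ε))

  p≤∣p∣ : ∀ p → p ≤ ∣ p ∣
  p≤∣p∣ p with ≤-total 0ℚ p
  ... | inj₁ 0≤p = ≤-reflexive (sym (0≤p⇒∣p∣≡p 0≤p))
  ... | inj₂ p≤0 = ≤-trans p≤0 (0≤∣p∣ p)

  -∣p∣≤p : ∀ p → - ∣ p ∣ ≤ p
  -∣p∣≤p p = subst₂ _≤_ (cong -_ (∣-p∣≡∣p∣ p)) (solve 1 (λ p → :- (:- p) := p) refl p)
               (neg-antimono-≤ (p≤∣p∣ (- p)))

  <ʳ-asym : ∀ {x y} → x <ʳ y → ¬ (y <ʳ x)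
  <ʳ-asym {x} {y} (δ , 0<δ , M , h) (ε , 0<ε , N , g) =
    let n = M ℕ.⊔ N
        open ≤-Reasoning
    in <-irrefl refl (begin-strict
         seq x n                 ≡⟨ +-identityʳ (seq x n) ⟨
         seq x n + 0ℚ            <⟨ +-monoʳ-< (seq x n) (+-mono-< 0<δ 0<ε) ⟩
         seq x n + (δ + ε)       ≡⟨ +-assoc (seq x n) δ ε ⟨
         seq x n + δ + ε         ≤⟨ +-monoˡ-≤ ε (h n (ℕ.m≤m⊔n M N)) ⟩
         seq y n + ε             ≤⟨ g n (ℕ.m≤n⊔m M N) ⟩
         seq x n                 ∎)

  <⇒≉ : ∀ {x y} → x <ʳ y → ¬ (x ≈ʳ y)
  <⇒≉ {x} {y} (ε , 0<ε , M , h) x≈y =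
    let η , η<ε , N , g = x≈y ε 0<ε
        n = M ℕ.⊔ N
        open ≤-Reasoning
    in <-irrefl refl (begin-strict
         ε                               ≡⟨ solve 2 (λ x e → e := (x :+ e) :- x) refl (seq x n) ε ⟩
         (seq x n + ε) - seq x n         ≤⟨ +-monoˡ-≤ (- seq x n) (h n (ℕ.m≤m⊔n M N)) ⟩
         seq y n - seq x n               ≤⟨ p≤∣p∣ (seq y n - seq x n) ⟩
         ∣ seq y n - seq x n ∣           ≡⟨ ∣p-q∣≡∣q-p∣ (seq y n) (seq x n) ⟩
         ∣ seq x n - seq y n ∣           ≤⟨ g n (ℕ.m≤n⊔m M N) ⟩
         η                               <⟨ η<ε ⟩
         ε                               ∎)

-- Straight segments as arcs: separation and crossing.

module Segments where
  open import Data.Nat.Base as ℕ using (ℕ)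
  import Data.Nat.Properties as ℕ
  open import Data.Product.Base using (∃-syntax; _×_; _,_; proj₁; proj₂)
  open import Data.Sum.Base using (inj₁; inj₂)
  open import Data.Rational.Base
    using (ℚ; 0ℚ; 1ℚ; _+_; _*_; _-_; -_; 1/_; ∣_∣; _<_; _≤_; _⊓_; NonZero; ≢-nonZero)
  open import Data.Rational.Properties
  open import Data.Rational.Solver using (module +-*-Solver)
  open import Function.Bundles using (mk⇔)
  open import Relation.Binary.PropositionalEquality
    using (_≡_; _≢_; refl; sym; trans; cong; cong₂; subst)
  open import Relation.Nullary.Decidable.Core using (Dec; yes; no)
  open import Relation.Nullary.Negation using (¬_; contradiction)
  open +-*-Solver using (solve; _:=_; _:+_; _:*_; _:-_; :-_; con)
  open Reals

  ℚ² : Set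
  ℚ² = ℚ × ℚ

  ⌜_⌝ : ℚ² → Point
  ⌜ x , y ⌝ = fromℚ x , fromℚ y

  ≈ᵖ-refl : ∀ {x} → x ≈ᵖ x
  ≈ᵖ-refl {x , y} = ≈-refl {x} , ≈-refl {y}

  ≈ᵖ-sym : ∀ {x y} → x ≈ᵖ y → y ≈ᵖ x
  ≈ᵖ-sym {x₁ , x₂} {y₁ , y₂} (h₁ , h₂) = ≈-sym {x₁} {y₁} h₁ , ≈-sym {x₂} {y₂} h₂

  ≈ᵖ-trans : ∀ {x y z} → x ≈ᵖ y → y ≈ᵖ z → x ≈ᵖ z
  ≈ᵖ-trans {x₁ , x₂} {y₁ , y₂} {z₁ , z₂} (h₁ , h₂) (k₁ , k₂) =
    ≈-trans {x₁} {y₁} {z₁} h₁ k₁ , ≈-trans {x₂} {y₂} {z₂} h₂ k₂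

  near-weaken : ∀ {δ ε x y} → δ ≤ ε → Near δ x y → Near ε x y
  near-weaken δ≤ε (η , η<δ , h) = η , <-≤-trans η<δ δ≤ε , h

  0<⊓ : ∀ {p q} → 0ℚ < p → 0ℚ < q → 0ℚ < p ⊓ q
  0<⊓ {p} {q} 0<p 0<q with ⊓-sel p q
  ... | inj₁ e = subst (0ℚ <_) (sym e) 0<p
  ... | inj₂ e = subst (0ℚ <_) (sym e) 0<q

  -- The first two arguments are the columns of the linear part, the third is the image of the
  -- origin.
  affine : ℚ² → ℚ² → ℚ² → Point → Point
  affine (u₁ , u₂) (v₁ , v₂) (c₁ , c₂) (x , y) = lin u₁ v₁ c₁ x y , lin u₂ v₂ c₂ x y

  affine-cong : ∀ u v c {x y} → x ≈ᵖ y → affine u v c x ≈ᵖ affine u v c y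
  affine-cong (u₁ , u₂) (v₁ , v₂) (c₁ , c₂) {x , y} {x′ , y′} (h , k) =
    lin-cong u₁ v₁ c₁ {x} {x′} {y} {y′} h k , lin-cong u₂ v₂ c₂ {x} {x′} {y} {y′} h k

  affine-continuous : ∀ u v c → Continuous Nearᵖ Nearᵖ (affine u v c)
  affine-continuous (u₁ , u₂) (v₁ , v₂) (c₁ , c₂) (x , y) ε 0<ε =
    δ₁ ⊓ δ₂ , 0<⊓ (shrink-pos u₁ v₁ 0<ε) (shrink-pos u₂ v₂ 0<ε) , λ (x′ , y′) (h , k) →
      lin-near u₁ v₁ c₁ {x} {x′} {y} {y′} 0<ε (near₁ x x′ h) (near₁ y y′ k) ,
      lin-near u₂ v₂ c₂ {x} {x′} {y} {y′} 0<ε (near₂ x x′ h) (near₂ y y′ k)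
    where
    δ₁ = shrink u₁ v₁ ε
    δ₂ = shrink u₂ v₂ ε
    near₁ : ∀ x x′ → Near (δ₁ ⊓ δ₂) x x′ → Near δ₁ x x′
    near₁ x x′ = near-weaken {x = x} {x′} (p⊓q≤p δ₁ δ₂)
    near₂ : ∀ x x′ → Near (δ₁ ⊓ δ₂) x x′ → Near δ₂ x x′
    near₂ x x′ = near-weaken {x = x} {x′} (p⊓q≤q δ₁ δ₂)

  _⊖_ : ℚ² → ℚ² → ℚ²
  (x , y) ⊖ (x′ , y′) = x - x′ , y - y′

  𝟎 : ℚ²
  𝟎 = 0ℚ , 0ℚ

  segment : ℚ² → ℚ² → ℝ → Point
  segment p q t = affine (q ⊖ p) 𝟎 p (t , t)

  segment-cong : ∀ p q {s t} → s ≈ʳ t → segment p q s ≈ᵖ segment p q t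
  segment-cong p q {s} {t} s≈t = affine-cong (q ⊖ p) 𝟎 p {s , s} {t , t} (s≈t , s≈t)

  segmentArc : ∀ p q → p ≢ q → Arc ⌜ p ⌝ ⌜ q ⌝
  segmentArc p@(p₁ , p₂) q@(q₁ , q₂) p≢q = record
    { at         = λ t → segment p q (proj₁ t)
    ; continuous = λ (t , _) ε 0<ε →
        let δ , 0<δ , h = affine-continuous (q ⊖ p) 𝟎 p (t , t) ε 0<ε
        in δ , 0<δ , λ (t′ , _) k → h (t′ , t′) (k , k)
    ; injective  = λ (s , _) (t , _) → inj s t
    ; start      = λ (t , _) t≈0 →
        ≈ᵖ-trans {segment p q t} {segment p q 0ℝ} {⌜ p ⌝} (segment-cong p q {t} {0ℝ} t≈0)
          ( ≗⇒≈ {lin (q₁ - p₁) 0ℚ p₁ 0ℝ 0ℝ} {fromℚ p₁} (λ _ → at-0 p₁ q₁)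
          , ≗⇒≈ {lin (q₂ - p₂) 0ℚ p₂ 0ℝ 0ℝ} {fromℚ p₂} (λ _ → at-0 p₂ q₂))
    ; end        = λ (t , _) t≈1 →
        ≈ᵖ-trans {segment p q t} {segment p q 1ℝ} {⌜ q ⌝} (segment-cong p q {t} {1ℝ} t≈1)
          ( ≗⇒≈ {lin (q₁ - p₁) 0ℚ p₁ 1ℝ 1ℝ} {fromℚ q₁} (λ _ → at-1 p₁ q₁)
          , ≗⇒≈ {lin (q₂ - p₂) 0ℚ p₂ 1ℝ 1ℝ} {fromℚ q₂} (λ _ → at-1 p₂ q₂))
    }
    where
    at-0 : ∀ p q → (q - p) * 0ℚ + 0ℚ * 0ℚ + p ≡ p
    at-0 = solve 2 (λ p q → (q :- p) :* con 0ℚ :+ con 0ℚ :* con 0ℚ :+ p := p) refl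
    at-1 : ∀ p q → (q - p) * 1ℚ + 0ℚ * 1ℚ + p ≡ q
    at-1 = solve 2 (λ p q → (q :- p) :* con 1ℚ :+ con 0ℚ :* con 1ℚ :+ p := q) refl

    -- The inverse affine map respects `≈ʳ`, hence it recovers the parameter from a coordinate whose
    -- slope d has the inverse i.
    invert : ∀ d i p → i * d ≡ 1ℚ → ∀ s t → lin d 0ℚ p s s ≈ʳ lin d 0ℚ p t t → s ≈ʳ t
    invert d i p id≡1 s t h =
      ≈-trans {s} {back s} {t} (≈-sym {back s} {s} (back-forth s))
        (≈-trans {back s} {back t} {t} (lin-cong i 0ℚ (- (i * p)) {forth s} {forth t} {forth s} {forth t} h h)
          (back-forth t))
      where
      forth back : ℝ → ℝ
      forth s = lin d 0ℚ p s s
      back s = lin i 0ℚ (- (i * p)) (forth s) (forth s)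
      back-forth : ∀ s → back s ≈ʳ s
      back-forth s = ≗⇒≈ {back s} {s} λ n → trans
        (solve 4 (λ i d s p →
           i :* (d :* s :+ con 0ℚ :* s :+ p) :+ con 0ℚ :* (d :* s :+ con 0ℚ :* s :+ p) :+ :- (i :* p)
           := (i :* d) :* s) refl i d (seq s n) p)
        (trans (cong (_* seq s n) id≡1) (*-identityˡ (seq s n)))

    cancel : ∀ p q → p ≢ q → ∀ s t →
             lin (q - p) 0ℚ p s s ≈ʳ lin (q - p) 0ℚ p t t → s ≈ʳ t
    cancel p q p≢q = invert (q - p) (1/ (q - p)) p (*-inverseˡ (q - p))
      where
      instance
        q-p≢0 : NonZero (q - p)
        q-p≢0 = ≢-nonZero {q - p} λ d≡0 → p≢q (sym (trans (solve 2 (λ p q → q := (q :- p) :+ p) refl p q)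
                  (trans (cong (_+ p) d≡0) (+-identityˡ p))))

    inj : ∀ s t → segment p q s ≈ᵖ segment p q t → s ≈ʳ t
    inj s t (h , k) = by-cases (p₁ ≟ q₁) (p₂ ≟ q₂)
      where
      -- Rational coordinates can be compared: one of them differs at p and q, and that one alone
      -- determines the parameter.
      by-cases : Dec (p₁ ≡ q₁) → Dec (p₂ ≡ q₂) → s ≈ʳ t
      by-cases (no p₁≢q₁) _          = cancel p₁ q₁ p₁≢q₁ s t h
      by-cases (yes _)    (no p₂≢q₂) = cancel p₂ q₂ p₂≢q₂ s t k
      by-cases (yes e₁)   (yes e₂)   = contradiction (cong₂ _,_ e₁ e₂) p≢q

  -- The line may pass through ends of the segments, so edges with a common end are covered.
  -- `strict` says that not all four ends lie on it, which suffices to keep interior points apart.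
  record Separation (p q p′ q′ : ℚ²) : Set where
    constructor separation
    field
      α β γ : ℚ
    ℓ : ℚ² → ℚ
    ℓ (x , y) = α * x + β * y
    field
      p≤ : ℓ p ≤ γ
      q≤ : ℓ q ≤ γ
      ≤p′ : γ ≤ ℓ p′
      ≤q′ : γ ≤ ℓ q′
      strict : ℓ p + ℓ q < ℓ p′ + ℓ q′

  Inside : ℝ → Set
  Inside t = 0ℝ <ʳ t × t <ʳ 1ℝ

  -- If both parameters keep distance ε from 0 and 1, every end has weight at least ε in its convex
  -- combination. So the values of the functional at the two points differ by at least ε times the
  -- gap in `strict`, which is a positive rational.
  separated : ∀ {p q p′ q′} → Separation p q p′ q′ → ∀ s t → Inside s → Inside t →
              ¬ (segment p q s ≈ᵖ segment p′ q′ t)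
  separated {p@(p₁ , p₂)} {q@(q₁ , q₂)} {p′@(p′₁ , p′₂)} {q′@(q′₁ , q′₂)} S s t
    ((ε₁ , 0<ε₁ , hs₀) , (ε₂ , 0<ε₂ , hs₁)) ((ε₃ , 0<ε₃ , ht₀) , (ε₄ , 0<ε₄ , ht₁)) (h , k) =
    <⇒≉ {f} {g} (ε * gap , 0<* 0<ε (0<q-p strict) ,
        both (both hs₀ hs₁ λ _ → _,_) (both ht₀ ht₁ λ _ → _,_) bound)
      (lin-cong α β 0ℚ {proj₁ (segment p q s)} {proj₁ (segment p′ q′ t)}
                       {proj₂ (segment p q s)} {proj₂ (segment p′ q′ t)} h k)
    where
    open Separation S
    f = lin α β 0ℚ (proj₁ (segment p q s)) (proj₂ (segment p q s))
    g = lin α β 0ℚ (proj₁ (segment p′ q′ t)) (proj₂ (segment p′ q′ t))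
    ε = (ε₁ ⊓ ε₂) ⊓ (ε₃ ⊓ ε₄)
    gap = (ℓ p′ + ℓ q′) - (ℓ p + ℓ q)
    0<ε = 0<⊓ (0<⊓ 0<ε₁ 0<ε₂) (0<⊓ 0<ε₃ 0<ε₄)
    ε≤₁ = ≤-trans (p⊓q≤p (ε₁ ⊓ ε₂) (ε₃ ⊓ ε₄)) (p⊓q≤p ε₁ ε₂)
    ε≤₂ = ≤-trans (p⊓q≤p (ε₁ ⊓ ε₂) (ε₃ ⊓ ε₄)) (p⊓q≤q ε₁ ε₂)
    ε≤₃ = ≤-trans (p⊓q≤q (ε₁ ⊓ ε₂) (ε₃ ⊓ ε₄)) (p⊓q≤p ε₃ ε₄)
    ε≤₄ = ≤-trans (p⊓q≤q (ε₁ ⊓ ε₂) (ε₃ ⊓ ε₄)) (p⊓q≤q ε₃ ε₄)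

    from0 : ∀ {e t} → ε ≤ e → 0ℚ + e ≤ t → 0ℚ ≤ t - ε
    from0 {e} {t} ε≤e h = 0≤q-p (≤-trans ε≤e (subst (_≤ t) (+-identityˡ e) h))
    to1 : ∀ {e t} → ε ≤ e → t + e ≤ 1ℚ → 0ℚ ≤ 1ℚ - t - ε
    to1 {e} {t} ε≤e h = subst (0ℚ ≤_) (solve 2 (λ t e → con 1ℚ :- (t :+ e) := con 1ℚ :- t :- e) refl t ε)
      (0≤q-p (≤-trans (+-monoʳ-≤ t ε≤e) h))

    value : ∀ p₁ p₂ q₁ q₂ x →
            α * ((q₁ - p₁) * x + 0ℚ * x + p₁) + β * ((q₂ - p₂) * x + 0ℚ * x + p₂) + 0ℚ
            ≡ (α * p₁ + β * p₂) + ((α * q₁ + β * q₂) - (α * p₁ + β * p₂)) * x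
    value = solve 7 (λ α β p₁ p₂ q₁ q₂ x →
      α :* ((q₁ :- p₁) :* x :+ con 0ℚ :* x :+ p₁) :+ β :* ((q₂ :- p₂) :* x :+ con 0ℚ :* x :+ p₂) :+ con 0ℚ
      := (α :* p₁ :+ β :* p₂) :+ ((α :* q₁ :+ β :* q₂) :- (α :* p₁ :+ β :* p₂)) :* x) refl α β

    bound : ∀ n → (0ℚ + ε₁ ≤ seq s n × seq s n + ε₂ ≤ 1ℚ) →
                  (0ℚ + ε₃ ≤ seq t n × seq t n + ε₄ ≤ 1ℚ) →
                  seq f n + ε * gap ≤ seq g n
    bound n (a , b) (c , d) = q-p≥0⇒p≤q (subst (0ℚ ≤_) identity
      (0≤+ (0≤+ (0≤* (to1 {t = x} ε≤₂ b) (0≤q-p p≤)) (0≤* (from0 ε≤₁ a) (0≤q-p q≤)))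
           (0≤+ (0≤* (to1 {t = y} ε≤₄ d) (0≤q-p ≤p′)) (0≤* (from0 ε≤₃ c) (0≤q-p ≤q′)))))
      where
      x = seq s n
      y = seq t n
      -- Weight ε of each end is spent on the gap; what remains is a combination with nonnegative
      -- coefficients of the four weak inequalities.
      identity : (1ℚ - x - ε) * (γ - ℓ p) + (x - ε) * (γ - ℓ q)
                 + ((1ℚ - y - ε) * (ℓ p′ - γ) + (y - ε) * (ℓ q′ - γ))
                 ≡ seq g n - (seq f n + ε * gap)
      identity = trans
        (solve 8 (λ a b c d m x y e →
           (con 1ℚ :- x :- e) :* (m :- a) :+ (x :- e) :* (m :- b)
           :+ ((con 1ℚ :- y :- e) :* (c :- m) :+ (y :- e) :* (d :- m))
           := (c :+ (d :- c) :* y)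
              :- ((a :+ (b :- a) :* x) :+ e :* ((c :+ d) :- (a :+ b))))
           refl (ℓ p) (ℓ q) (ℓ p′) (ℓ q′) γ x y ε)
        (sym (cong₂ (λ f g → g - (f + ε * gap))
          (value p₁ p₂ q₁ q₂ x) (value p′₁ p′₂ q′₁ q′₂ y)))

  det : ℚ² → ℚ² → ℚ
  det (u₁ , u₂) (v₁ , v₂) = u₁ * v₂ - u₂ * v₁

  -- Invertibility is given as an equation for the inverse determinant `k`, so the inverse map is
  -- polynomial in the data, and both composites are the identity up to rewriting with this
  -- equation.
  module Frame (u v c : ℚ²) (k : ℚ) (k-det : k * det u v ≡ 1ℚ) where
    private
      u₁ = proj₁ u ; u₂ = proj₂ u
      v₁ = proj₁ v ; v₂ = proj₂ v
      c₁ = proj₁ c ; c₂ = proj₂ c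
      -- The adjugate matrix times `k`, and minus the image of `c` under it.
      u⁻ v⁻ c⁻ : ℚ²
      u⁻ = k * v₂ , - (k * u₂)
      v⁻ = - (k * v₁) , k * u₁
      c⁻ = k * (v₁ * c₂ - v₂ * c₁) , k * (u₂ * c₁ - u₁ * c₂)

    to from : Point → Point
    to = affine u v c
    from = affine u⁻ v⁻ c⁻

    private
      unit : ∀ x → k * det u v * x ≡ x
      unit x = trans (cong (_* x) k-det) (*-identityˡ x)

    to-from : ∀ x → to (from x) ≈ᵖ x
    to-from (x , y) =
      ≗⇒≈ {proj₁ (to (from (x , y)))} {x} (λ n → trans
        (solve 9 (λ k u₁ u₂ v₁ v₂ c₁ c₂ x y →
           u₁ :* ((k :* v₂) :* x :+ (:- (k :* v₁)) :* y :+ k :* (v₁ :* c₂ :- v₂ :* c₁))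
           :+ v₁ :* ((:- (k :* u₂)) :* x :+ (k :* u₁) :* y :+ k :* (u₂ :* c₁ :- u₁ :* c₂)) :+ c₁
           := (k :* (u₁ :* v₂ :- u₂ :* v₁)) :* (x :- c₁) :+ c₁)
           refl k u₁ u₂ v₁ v₂ c₁ c₂ (seq x n) (seq y n))
        (back (seq x n) c₁)) ,
      ≗⇒≈ {proj₂ (to (from (x , y)))} {y} (λ n → trans
        (solve 9 (λ k u₁ u₂ v₁ v₂ c₁ c₂ x y →
           u₂ :* ((k :* v₂) :* x :+ (:- (k :* v₁)) :* y :+ k :* (v₁ :* c₂ :- v₂ :* c₁))
           :+ v₂ :* ((:- (k :* u₂)) :* x :+ (k :* u₁) :* y :+ k :* (u₂ :* c₁ :- u₁ :* c₂)) :+ c₂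
           := (k :* (u₁ :* v₂ :- u₂ :* v₁)) :* (y :- c₂) :+ c₂)
           refl k u₁ u₂ v₁ v₂ c₁ c₂ (seq x n) (seq y n))
        (back (seq y n) c₂))
      where
      back : ∀ x c → k * det u v * (x - c) + c ≡ x
      back x c = trans (cong (_+ c) (unit (x - c))) (solve 2 (λ x c → x :- c :+ c := x) refl x c)

    from-to : ∀ x → from (to x) ≈ᵖ x
    from-to (x , y) =
      ≗⇒≈ {proj₁ (from (to (x , y)))} {x} (λ n → trans
        (solve 9 (λ k u₁ u₂ v₁ v₂ c₁ c₂ x y →
           (k :* v₂) :* (u₁ :* x :+ v₁ :* y :+ c₁) :+ (:- (k :* v₁)) :* (u₂ :* x :+ v₂ :* y :+ c₂)
           :+ k :* (v₁ :* c₂ :- v₂ :* c₁)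
           := (k :* (u₁ :* v₂ :- u₂ :* v₁)) :* x)
           refl k u₁ u₂ v₁ v₂ c₁ c₂ (seq x n) (seq y n))
        (unit (seq x n))) ,
      ≗⇒≈ {proj₂ (from (to (x , y)))} {y} (λ n → trans
        (solve 9 (λ k u₁ u₂ v₁ v₂ c₁ c₂ x y →
           (:- (k :* u₂)) :* (u₁ :* x :+ v₁ :* y :+ c₁) :+ (k :* u₁) :* (u₂ :* x :+ v₂ :* y :+ c₂)
           :+ k :* (u₂ :* c₁ :- u₁ :* c₂)
           := (k :* (u₁ :* v₂ :- u₂ :* v₁)) :* y)
           refl k u₁ u₂ v₁ v₂ c₁ c₂ (seq x n) (seq y n))
        (unit (seq y n)))

    from-cong : ∀ {x y} → x ≈ᵖ y → from x ≈ᵖ from y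
    from-cong {x} {y} = affine-cong u⁻ v⁻ c⁻ {x} {y}

    homeomorphism : Homeomorphism
    homeomorphism = record
      { to = to ; from = from
      ; to-cont = affine-continuous u v c
      ; from-cont = affine-continuous u⁻ v⁻ c⁻
      ; to-from = to-from ; from-to = from-to }

    to-origin : to (0ℝ , 0ℝ) ≈ᵖ ⌜ c ⌝
    to-origin = ≗⇒≈ {lin u₁ v₁ c₁ 0ℝ 0ℝ} {fromℚ c₁} (λ _ → zeros u₁ v₁ c₁) ,
                ≗⇒≈ {lin u₂ v₂ c₂ 0ℝ 0ℝ} {fromℚ c₂} (λ _ → zeros u₂ v₂ c₂)
      where
      zeros : ∀ u v c → u * 0ℚ + v * 0ℚ + c ≡ c
      zeros = solve 3 (λ u v c → u :* con 0ℚ :+ v :* con 0ℚ :+ c := c) refl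

  _⊙_ : ℚ → ℚ² → ℚ²
  r ⊙ (x , y) = r * x , r * y

  _⟨_⟩_ : ℚ² → ℚ → ℚ² → ℚ²
  (p₁ , p₂) ⟨ t ⟩ (q₁ , q₂) = p₁ + t * (q₁ - p₁) , p₂ + t * (q₂ - p₂)

  -- A frame with its origin on the segment, at parameter t, and its first axis along the segment.
  -- Scaling this axis by ε fits the unit neighbourhood in `CrossAt`: coordinates a with |a| < 1
  -- correspond to parameters between t - ε and t + ε, hence between 0 and 1. The second axis `v` is
  -- any transverse vector.
  module Axis (p q : ℚ²) (p≢q : p ≢ q) (t ε : ℚ) (ε≤t : ε ≤ t) (t+ε≤1 : t + ε ≤ 1ℚ) (0<ε : 0ℚ < ε)
              (v : ℚ²) (k : ℚ) (k-det : k * det (ε ⊙ (q ⊖ p)) v ≡ 1ℚ) where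
    private
      p₁ = proj₁ p ; p₂ = proj₂ p
      q₁ = proj₁ q ; q₂ = proj₂ q
      v₁ = proj₁ v ; v₂ = proj₂ v
      u = ε ⊙ (q ⊖ p)
      c = p ⟨ t ⟩ q
      u₁ = proj₁ u ; u₂ = proj₂ u
      c₁ = proj₁ c ; c₂ = proj₂ c
    open Frame u v c k k-det

    axis⁻ : ∀ a b → OnArc (segmentArc p q p≢q) (to (a , b)) → b ≈ʳ 0ℝ
    axis⁻ a b ((τ , _) , h) =
      ≈-trans {b} {proj₂ (from (to (a , b)))} {0ℝ}
        (≈-sym {proj₂ (from (to (a , b)))} {b} (proj₂ (from-to (a , b))))
        (≈-trans {proj₂ (from (to (a , b)))} {proj₂ (from (segment p q τ))} {0ℝ}
          (≈-sym {proj₂ (from (segment p q τ))} {proj₂ (from (to (a , b)))}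
            (proj₂ (from-cong {segment p q τ} {to (a , b)} h)))
          (≗⇒≈ {proj₂ (from (segment p q τ))} {0ℝ} λ n →
            solve 8 (λ k e t p₁ p₂ q₁ q₂ s →
              (:- (k :* (e :* (q₂ :- p₂)))) :* ((q₁ :- p₁) :* s :+ con 0ℚ :* s :+ p₁)
              :+ (k :* (e :* (q₁ :- p₁))) :* ((q₂ :- p₂) :* s :+ con 0ℚ :* s :+ p₂)
              :+ k :* ((e :* (q₂ :- p₂)) :* (p₁ :+ t :* (q₁ :- p₁)) :- (e :* (q₁ :- p₁)) :* (p₂ :+ t :* (q₂ :- p₂)))
              := con 0ℚ) refl k ε t p₁ p₂ q₁ q₂ (seq τ n)))

    axis⁺ : ∀ a b → Near 1ℚ a 0ℝ → b ≈ʳ 0ℝ → OnArc (segmentArc p q p≢q) (to (a , b))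
    axis⁺ a b (η , η<1 , near) b≈0 =
      (τ , 0≤τ , τ≤1) ,
      ≈ᵖ-trans {segment p q τ} {to (a , 0ℝ)} {to (a , b)}
        ( ≗⇒≈ {proj₁ (segment p q τ)} {proj₁ (to (a , 0ℝ))} (λ n → point p₁ q₁ v₁ (seq a n))
        , ≗⇒≈ {proj₂ (segment p q τ)} {proj₂ (to (a , 0ℝ))} (λ n → point p₂ q₂ v₂ (seq a n)))
        (affine-cong u v c {a , 0ℝ} {a , b} (≈-refl {a} , ≈-sym {b} {0ℝ} b≈0))
      where
      -- The point with frame coordinates (a , 0) has parameter t + εa on the segment.
      τ = lin ε 0ℚ t a a
      point : ∀ p q v a → (q - p) * (ε * a + 0ℚ * a + t) + 0ℚ * (ε * a + 0ℚ * a + t) + p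
                        ≡ ε * (q - p) * a + v * 0ℚ + (p + t * (q - p))
      point p q v a = solve 6 (λ e t p q v a →
        (q :- p) :* (e :* a :+ con 0ℚ :* a :+ t) :+ con 0ℚ :* (e :* a :+ con 0ℚ :* a :+ t) :+ p
        := e :* (q :- p) :* a :+ v :* con 0ℚ :+ (p :+ t :* (q :- p))) refl ε t p q v a

      small : ∀ n → ∣ seq a n - 0ℚ ∣ ≤ η → ∣ ε * seq a n ∣ ≤ ε
      small n h = begin
        ∣ ε * seq a n ∣          ≡⟨ ∣p*q∣≡∣p∣*∣q∣ ε (seq a n) ⟩
        ∣ ε ∣ * ∣ seq a n ∣      ≡⟨ cong₂ (λ e x → e * ∣ x ∣) (0≤p⇒∣p∣≡p (<⇒≤ 0<ε))
                                    (solve 1 (λ a → a := a :- con 0ℚ) refl (seq a n)) ⟩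
        ε * ∣ seq a n - 0ℚ ∣     ≤⟨ *-mono-≤-nonNeg ε (<⇒≤ 0<ε) (≤-trans h (<⇒≤ η<1)) ⟩
        ε * 1ℚ                   ≡⟨ *-identityʳ ε ⟩
        ε                        ∎
        where open ≤-Reasoning

      shape : ∀ a → ε * a + 0ℚ * a + t ≡ t + ε * a
      shape a = solve 3 (λ e t a → e :* a :+ con 0ℚ :* a :+ t := t :+ e :* a) refl ε t a

      0≤τ : 0ℝ ≤ʳ τ
      0≤τ (δ , 0<δ , M , h) =
        let N , g = near
            n = M ℕ.⊔ N
            x = ε * seq a n
            open ≤-Reasoning
        in <-irrefl refl (begin-strict
          0ℚ                                   ≤⟨ 0≤q-p (small n (g n (ℕ.m≤n⊔m M N))) ⟩
          ε - ∣ x ∣                            ≤⟨ +-monoˡ-≤ (- ∣ x ∣) ε≤t ⟩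
          t - ∣ x ∣                            ≤⟨ +-monoʳ-≤ t (-∣p∣≤p x) ⟩
          t + x                                ≡⟨ +-identityʳ (t + x) ⟨
          t + x + 0ℚ                           <⟨ +-monoʳ-< (t + x) 0<δ ⟩
          t + x + δ                            ≡⟨ cong (_+ δ) (shape (seq a n)) ⟨
          seq τ n + δ                          ≤⟨ h n (ℕ.m≤m⊔n M N) ⟩
          0ℚ                                   ∎)

      τ≤1 : τ ≤ʳ 1ℝ
      τ≤1 (δ , 0<δ , M , h) =
        let N , g = near
            n = M ℕ.⊔ N
            x = ε * seq a n
            open ≤-Reasoning
        in <-irrefl refl (begin-strict
          1ℚ                                   ≡⟨ +-identityʳ 1ℚ ⟨
          1ℚ + 0ℚ                              <⟨ +-monoʳ-< 1ℚ 0<δ ⟩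
          1ℚ + δ                               ≤⟨ h n (ℕ.m≤m⊔n M N) ⟩
          seq τ n                              ≡⟨ shape (seq a n) ⟩
          t + x                                ≤⟨ +-monoʳ-≤ t (≤-trans (p≤∣p∣ x) (small n (g n (ℕ.m≤n⊔m M N)))) ⟩
          t + ε                                ≤⟨ t+ε≤1 ⟩
          1ℚ                                   ∎)

  -- A certificate in decidable rational statements: the parameters of the common point, a margin ε
  -- for both of them, and the inverse determinant of the frame spanned by the two directions scaled
  -- by ε.
  record Crossing (p q p′ q′ : ℚ²) : Set where
    field
      s t ε k : ℚ
      0<ε    : 0ℚ < ε
      ε≤s    : ε ≤ s
      s+ε≤1  : s + ε ≤ 1ℚ
      ε≤t    : ε ≤ t
      t+ε≤1  : t + ε ≤ 1ℚ
      meet   : p ⟨ s ⟩ q ≡ p′ ⟨ t ⟩ q′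
      k-det  : k * det (ε ⊙ (q ⊖ p)) (ε ⊙ (q′ ⊖ p′)) ≡ 1ℚ

  module _ {p q p′ q′ : ℚ²} (p≢q : p ≢ q) (p′≢q′ : p′ ≢ q′) (C : Crossing p q p′ q′) where
    open Crossing C
    private
      γ = segmentArc p q p≢q
      γ′ = segmentArc p′ q′ p′≢q′
      u = ε ⊙ (q ⊖ p)
      v = ε ⊙ (q′ ⊖ p′)
      c = p ⟨ s ⟩ q

      -- With the axes exchanged, `Axis` serves the second segment as well; the determinant changes
      -- its sign.
      k-det′ : (- k) * det v u ≡ 1ℚ
      k-det′ = trans (solve 5 (λ k u₁ u₂ v₁ v₂ → (:- k) :* (v₁ :* u₂ :- v₂ :* u₁) := k :* (u₁ :* v₂ :- u₂ :* v₁))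
                       refl k (proj₁ u) (proj₂ u) (proj₁ v) (proj₂ v)) k-det

      swap : ∀ a b → affine u v c (a , b) ≈ᵖ affine v u (p′ ⟨ t ⟩ q′) (b , a)
      swap a b = subst (λ c′ → affine u v c (a , b) ≈ᵖ affine v u c′ (b , a)) meet
        ( ≗⇒≈ {proj₁ (affine u v c (a , b))} {proj₁ (affine v u c (b , a))}
              (λ n → cong (_+ proj₁ c) (+-comm (proj₁ u * seq a n) (proj₁ v * seq b n)))
        , ≗⇒≈ {proj₂ (affine u v c (a , b))} {proj₂ (affine v u c (b , a))}
              (λ n → cong (_+ proj₂ c) (+-comm (proj₂ u * seq a n) (proj₂ v * seq b n))))

      module F = Frame u v c k k-det
      module A = Axis p q p≢q s ε ε≤s s+ε≤1 0<ε v k k-det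
      module A′ = Axis p′ q′ p′≢q′ t ε ε≤t t+ε≤1 0<ε u (- k) k-det′

    OnArc-resp : ∀ {p q x y} (γ : Arc p q) → x ≈ᵖ y → OnArc γ x → OnArc γ y
    OnArc-resp {x = x} {y} γ x≈y (t , h) = t , ≈ᵖ-trans {Arc.at γ t} {x} {y} h x≈y

    γ′⇒a≈0 : ∀ a b → OnArc γ′ (F.to (a , b)) → a ≈ʳ 0ℝ
    γ′⇒a≈0 a b on = A′.axis⁻ b a (OnArc-resp {x = F.to (a , b)} {affine v u (p′ ⟨ t ⟩ q′) (b , a)} γ′ (swap a b) on)

    -- In the frame of the crossing the two arcs lie on the two axes, so a common point has both
    -- coordinates zero. This identifies the arbitrary point of `crossAt` with the origin of the
    -- frame, and it also shows that two edges have at most one crossing point.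
    meet-unique : ∀ x → OnArc γ x → OnArc γ′ x → x ≈ᵖ ⌜ c ⌝
    meet-unique x on on′ =
      ≈ᵖ-trans {x} {F.to (a , b)} {⌜ c ⌝} x≈
        (≈ᵖ-trans {F.to (a , b)} {F.to (0ℝ , 0ℝ)} {⌜ c ⌝}
          (affine-cong u v c {a , b} {0ℝ , 0ℝ} (γ′⇒a≈0 a b (OnArc-resp {x = x} {F.to (a , b)} γ′ x≈ on′) ,
                                                A.axis⁻ a b (OnArc-resp {x = x} {F.to (a , b)} γ x≈ on)))
          F.to-origin)
      where
      a = proj₁ (F.from x)
      b = proj₂ (F.from x)
      x≈ : x ≈ᵖ F.to (a , b)
      x≈ = ≈ᵖ-sym {F.to (a , b)} {x} (F.to-from x)

    crossAt : ∀ x → InInterior γ x → InInterior γ′ x → CrossAt γ γ′ x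
    crossAt x on@(τ , _ , _ , h) on′@(τ′ , _ , _ , h′) = on , on′ , F.homeomorphism ,
      ≈ᵖ-trans {F.to (0ℝ , 0ℝ)} {⌜ c ⌝} {x} F.to-origin (≈ᵖ-sym {x} {⌜ c ⌝} (meet-unique x (τ , h) (τ′ , h′))) ,
      λ a b near-a near-b →
        mk⇔ (A.axis⁻ a b) (A.axis⁺ a b near-a) ,
        mk⇔ (γ′⇒a≈0 a b)
            (λ a≈0 → OnArc-resp {x = affine v u (p′ ⟨ t ⟩ q′) (b , a)} {F.to (a , b)} γ′
               (≈ᵖ-sym {F.to (a , b)} {affine v u (p′ ⟨ t ⟩ q′) (b , a)} (swap a b))
               (A′.axis⁺ b a near-b a≈0))

    -- Existence of the crossing is what forbids a plane subgraph to contain both edges of a pair.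
    crosses : ∃[ x ] CrossAt γ γ′ x
    crosses = ⌜ c ⌝ , crossAt ⌜ c ⌝ (inside p q p≢q s ε≤s s+ε≤1)
        (subst (λ c → InInterior γ′ ⌜ c ⌝) (sym meet) (inside p′ q′ p′≢q′ t ε≤t t+ε≤1))
      where
      at : ∀ p q r → (q - p) * r + 0ℚ * r + p ≡ p + r * (q - p)
      at = solve 3 (λ p q r → (q :- p) :* r :+ con 0ℚ :* r :+ p := p :+ r :* (q :- p)) refl
      inside : ∀ p q p≢q r → ε ≤ r → r + ε ≤ 1ℚ → InInterior (segmentArc p q p≢q) ⌜ p ⟨ r ⟩ q ⌝
      inside p@(p₁ , p₂) q@(q₁ , q₂) p≢q r ε≤r r+ε≤1 =
        (fromℚ r , (λ r<0 → <ʳ-asym {fromℚ r} {0ℝ} r<0 0<r) , λ 1<r → <ʳ-asym {1ℝ} {fromℚ r} 1<r r<1) ,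
        0<r , r<1 ,
        ≗⇒≈ {proj₁ (segment p q (fromℚ r))} {fromℚ (p₁ + r * (q₁ - p₁))} (λ _ → at p₁ q₁ r) ,
        ≗⇒≈ {proj₂ (segment p q (fromℚ r))} {fromℚ (p₂ + r * (q₂ - p₂))} (λ _ → at p₂ q₂ r)
        where
        0<r : 0ℝ <ʳ fromℚ r
        0<r = ε , 0<ε , always λ _ → subst (_≤ r) (sym (+-identityˡ ε)) ε≤r
        r<1 : fromℚ r <ʳ 1ℝ
        r<1 = ε , 0<ε , always λ _ → r+ε≤1

-- The graphs and their 3-connectedness.

module Graphs where
  open import Data.Bool.Base using (T)
  open import Data.Fin.Base as Fin using (Fin; zero; suc; toℕ; fromℕ<)
  import Data.Fin.Properties as Fin
  open import Data.List.Base
    using (List; []; _∷_; _++_; [_]; map; reverse; _ʳ++_; concatMap; applyDownFrom; head)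
  open import Data.List.Membership.Propositional using (_∈_)
  open import Data.List.Membership.Propositional.Properties using (∈-map⁺; ∈-++⁻)
  import Data.List.Properties as List
  open import Data.List.Relation.Binary.Disjoint.Propositional using (Disjoint)
  open import Data.List.Relation.Unary.All as All using (All; []; _∷_)
  import Data.List.Relation.Unary.All.Properties as All
  open import Data.List.Relation.Unary.AllPairs using ([]; _∷_)
  open import Data.List.Relation.Unary.Any using (here)
  open import Data.List.Relation.Unary.Any.Properties using (reverse⁻)
  open import Data.List.Relation.Unary.Linked as Linked using (Linked; []; [-]; _∷_)
  import Data.List.Relation.Unary.Linked.Properties as Linked
  open import Data.List.Relation.Unary.Unique.Propositional using (Unique)
  import Data.List.Relation.Unary.Unique.Propositional.Properties as Unique
  open import Data.Maybe.Base using (just)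
  import Data.Maybe.Properties as Maybe
  open import Data.Nat.Base using (ℕ; zero; suc; _+_; _∸_; _≤_; _<_; z≤n; s≤s)
  open import Data.Nat.Properties
  open import Data.Product.Base using (∃-syntax; _×_; _,_; proj₁; proj₂)
  import Data.Product.Properties as Product
  open import Data.Sum.Base using (_⊎_; inj₁; inj₂; swap)
  open import Data.Vec.Base using (lookup; []; _∷_)
  open import Function.Bundles using (mk⇔)
  open import Relation.Binary.Definitions using (DecidableEquality; tri<; tri≈; tri>)
  open import Relation.Binary.PropositionalEquality
    using (_≡_; _≢_; refl; sym; trans; cong; cong₂; subst; setoid)
  open import Relation.Nullary.Decidable
    using (Dec; does; yes; no; map′; _×-dec_; _⊎-dec_; _→-dec_; ¬?; toWitness; dec-false;
      dec-true; does-⇔)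
  open import Relation.Nullary.Negation using (contradiction)
  import Data.List.Membership.DecPropositional as DecMembership
  import Data.List.Relation.Binary.Disjoint.DecPropositional as DecDisjoint
  import Data.List.Relation.Unary.Unique.DecPropositional as DecUnique
  import Data.List.Relation.Binary.Permutation.Setoid.Properties as SetoidPermutation

  -- Every edge at one of the vertices 2, …, 12 occurs exactly once here.
  crossingPairs : List ((ℕ × ℕ) × (ℕ × ℕ))
  crossingPairs =
    ((0 , 2) , (1 , 3)) ∷ ((0 , 12) , (7 , 13)) ∷ ((1 , 11) , (4 , 13)) ∷
    ((2 , 6) , (3 , 5)) ∷ ((2 , 8) , (4 , 5)) ∷ ((3 , 9) , (6 , 7)) ∷
    ((4 , 10) , (8 , 11)) ∷ ((5 , 9) , (6 , 8)) ∷ ((7 , 10) , (9 , 12)) ∷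
    ((10 , 13) , (11 , 12)) ∷ []

  gadgetEdges : List (ℕ × ℕ)
  gadgetEdges = concatMap (λ (e , f) → e ∷ f ∷ []) crossingPairs

  -- The edges of one infinite graph on ℕ, directed from the smaller to the larger end. Each member
  -- of the family is the subgraph induced by an initial segment.
  data Link : ℕ → ℕ → Set where
    gadget : ∀ {u v} → (u , v) ∈ gadgetEdges → Link u v
    spoke₀ : ∀ k → Link 0 (13 + k)
    spoke₁ : ∀ k → Link 1 (13 + k)
    rim    : ∀ k → Link (13 + k) (14 + k)

  Joined : ℕ → ℕ → Set
  Joined u v = Link u v ⊎ Link v u

  _≟ᵉ_ : DecidableEquality (ℕ × ℕ)
  _≟ᵉ_ = Product.≡-dec _≟_ _≟_

  open DecMembership _≟ᵉ_ using (_∈?_)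
  open DecDisjoint _≟_ using (disjoint?)
  open DecUnique _≟_ using (unique?)

  from-13 : (P : ℕ → Set) → (∀ k → P (13 + k)) → ∀ {m} → 13 ≤ m → P m
  from-13 P p {m} 13≤m = subst P (m+[n∸m]≡n 13≤m) (p (m ∸ 13))

  link? : ∀ u v → Dec (Link u v)
  link? u v = map′ to from
    ((u , v) ∈? gadgetEdges ⊎-dec (u ≟ 0 ×-dec 13 ≤? v) ⊎-dec (u ≟ 1 ×-dec 13 ≤? v) ⊎-dec
     (13 ≤? u ×-dec v ≟ suc u))
    where
    Cases = (u , v) ∈ gadgetEdges ⊎ (u ≡ 0 × 13 ≤ v) ⊎ (u ≡ 1 × 13 ≤ v) ⊎ (13 ≤ u × v ≡ suc u)
    to : Cases → Link u v
    to (inj₁ e)                              = gadget e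
    to (inj₂ (inj₁ (refl , 13≤v)))           = from-13 (Link 0) spoke₀ 13≤v
    to (inj₂ (inj₂ (inj₁ (refl , 13≤v))))    = from-13 (Link 1) spoke₁ 13≤v
    to (inj₂ (inj₂ (inj₂ (13≤u , refl))))    = from-13 (λ u → Link u (suc u)) rim 13≤u
    from : Link u v → Cases
    from (gadget e) = inj₁ e
    from (spoke₀ k) = inj₂ (inj₁ (refl , m≤m+n 13 k))
    from (spoke₁ k) = inj₂ (inj₂ (inj₁ (refl , m≤m+n 13 k)))
    from (rim k)    = inj₂ (inj₂ (inj₂ (m≤m+n 13 k , refl)))

  joined? : ∀ u v → Dec (Joined u v)
  joined? u v = link? u v ⊎-dec link? v u

  abstract
    gadget-bounds : All (λ (u , v) → u < v × v < 14) gadgetEdges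
    gadget-bounds = toWitness {a? = All.all? (λ (u , v) → (u <? v) ×-dec (v <? 14)) gadgetEdges} _

  link⇒< : ∀ {u v} → Link u v → u < v
  link⇒< (gadget e) = proj₁ (All.lookup gadget-bounds e)
  link⇒< (spoke₀ k) = s≤s z≤n
  link⇒< (spoke₁ k) = s≤s (s≤s z≤n)
  link⇒< (rim k)    = ≤-refl

  T-does⁻ : ∀ {P : Set} (d : Dec P) → T (does d) → P
  T-does⁻ (yes p) _ = p

  T-does⁺ : ∀ {P : Set} (d : Dec P) → P → T (does d)
  T-does⁺ d p = subst T (sym (dec-true d p)) _

  hubGraph : ∀ n → Graph n
  hubGraph n = record
    { adj      = λ u v → does (joined? (toℕ u) (toℕ v))
    ; adj-sym  = λ u v → does-⇔ (mk⇔ swap swap) (joined? (toℕ u) (toℕ v)) (joined? (toℕ v) (toℕ u))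
    ; loopless = λ v → dec-false (joined? (toℕ v) (toℕ v)) λ
        { (inj₁ l) → n≮n _ (link⇒< l) ; (inj₂ l) → n≮n _ (link⇒< l) }
    }

  record Route (u v : ℕ) (xs : List ℕ) : Set where
    constructor route
    field
      linked : Linked Joined (u ∷ xs ++ [ v ])
      unique : Unique (u ∷ xs ++ [ v ])

  Separate : (Fin 3 → List ℕ) → Set
  Separate P = ∀ i j → i ≢ j → P i ≢ P j × Disjoint (P i) (P j)

  -- Lists of natural numbers serve all orders at once; `bounded` permits the passage to `Fin n`.
  record Routes (n u v : ℕ) (P : Fin 3 → List ℕ) : Set where
    constructor routes
    field
      routed   : ∀ i → Route u v (P i)
      bounded  : ∀ i → All (_< n) (P i)
      separate : Separate P

  route? : ∀ u v xs → Dec (Route u v xs)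
  route? u v xs = map′ (λ (l , q) → route l q) (λ (route l q) → l , q)
    (Linked.linked? joined? (u ∷ xs ++ [ v ]) ×-dec unique? (u ∷ xs ++ [ v ]))

  _≟ˡ_ : DecidableEquality (List ℕ)
  _≟ˡ_ = List.≡-dec _≟_

  separate? : ∀ P → Dec (Separate P)
  separate? P = Fin.all? λ i → Fin.all? λ j →
    ¬? (i Fin.≟ j) →-dec (¬? (P i ≟ˡ P j) ×-dec disjoint? (P i) (P j))

  routes? : ∀ n u v P → Dec (Routes n u v P)
  routes? n u v P = map′ (λ (r , b , s) → routes r b s) (λ (routes r b s) → r , b , s)
    (Fin.all? (λ i → route? u v (P i)) ×-dec
     (Fin.all? (λ i → All.all? (_<? n) (P i)) ×-dec separate? P))

  three : List ℕ → List ℕ → List ℕ → Fin 3 → List ℕ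
  three xs ys zs = lookup (xs ∷ ys ∷ zs ∷ [])

  -- For v < 14: the vertices other than v of paths to v from 0, 1 and 13.
  fan : ℕ → Fin 3 → List ℕ
  fan 0 = three [] (1 ∷ 11 ∷ 12 ∷ []) [ 13 ]
  fan 1 = three (0 ∷ 12 ∷ 11 ∷ []) [] [ 13 ]
  fan 2 = three [ 0 ] (1 ∷ 11 ∷ 8 ∷ []) (13 ∷ 7 ∷ 6 ∷ [])
  fan 3 = three (0 ∷ 12 ∷ 9 ∷ []) [ 1 ] (13 ∷ 4 ∷ 5 ∷ [])
  fan 4 = three (0 ∷ 2 ∷ 6 ∷ 7 ∷ 10 ∷ []) (1 ∷ 3 ∷ 5 ∷ []) [ 13 ]
  fan 5 = three (0 ∷ 12 ∷ 9 ∷ []) (1 ∷ 3 ∷ []) (13 ∷ 4 ∷ [])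
  fan 6 = three (0 ∷ 2 ∷ []) (1 ∷ 11 ∷ 8 ∷ []) (13 ∷ 7 ∷ [])
  fan 7 = three (0 ∷ 2 ∷ 6 ∷ []) (1 ∷ 3 ∷ 5 ∷ 4 ∷ 10 ∷ []) [ 13 ]
  fan 8 = three (0 ∷ 2 ∷ []) (1 ∷ 11 ∷ []) (13 ∷ 7 ∷ 6 ∷ [])
  fan 9 = three (0 ∷ 12 ∷ []) (1 ∷ 3 ∷ []) (13 ∷ 4 ∷ 5 ∷ [])
  fan 10 = three (0 ∷ 2 ∷ 6 ∷ 7 ∷ []) (1 ∷ 3 ∷ 5 ∷ 4 ∷ []) [ 13 ]
  fan 11 = three (0 ∷ 12 ∷ []) [ 1 ] (13 ∷ 7 ∷ 6 ∷ 8 ∷ [])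
  fan 12 = three [ 0 ] (1 ∷ 11 ∷ []) (13 ∷ 4 ∷ 5 ∷ 9 ∷ [])
  fan 13 = three [ 0 ] [ 1 ] []
  fan _ = three [] [] []

  -- For v < u < 14: the internal vertices of three paths from u to v.
  detours : ℕ → ℕ → Fin 3 → List ℕ
  detours 1 0 = three [ 13 ] [ 14 ] (11 ∷ 12 ∷ [])
  detours 2 0 = three [] (6 ∷ 7 ∷ 13 ∷ []) (8 ∷ 11 ∷ 12 ∷ [])
  detours 2 1 = three (0 ∷ 14 ∷ []) (8 ∷ 11 ∷ []) (6 ∷ 7 ∷ 13 ∷ [])
  detours 3 0 = three (1 ∷ 14 ∷ []) (9 ∷ 12 ∷ []) (5 ∷ 4 ∷ 13 ∷ [])
  detours 3 1 = three [] (5 ∷ 4 ∷ 13 ∷ []) (9 ∷ 12 ∷ 11 ∷ [])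
  detours 3 2 = three (1 ∷ 11 ∷ 8 ∷ []) (9 ∷ 12 ∷ 0 ∷ []) (5 ∷ 4 ∷ 13 ∷ 7 ∷ 6 ∷ [])
  detours 4 0 = three [ 13 ] (5 ∷ 9 ∷ 12 ∷ []) (10 ∷ 7 ∷ 6 ∷ 2 ∷ [])
  detours 4 1 = three [ 13 ] (5 ∷ 3 ∷ []) (10 ∷ 7 ∷ 6 ∷ 8 ∷ 11 ∷ [])
  detours 4 2 = three (13 ∷ 0 ∷ []) (10 ∷ 7 ∷ 6 ∷ []) (5 ∷ 3 ∷ 1 ∷ 11 ∷ 8 ∷ [])
  detours 4 3 = three [ 5 ] (13 ∷ 1 ∷ []) (10 ∷ 7 ∷ 6 ∷ 2 ∷ 0 ∷ 12 ∷ 9 ∷ [])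
  detours 5 0 = three (4 ∷ 13 ∷ []) (9 ∷ 12 ∷ []) (3 ∷ 1 ∷ 14 ∷ [])
  detours 5 1 = three [ 3 ] (4 ∷ 13 ∷ []) (9 ∷ 12 ∷ 11 ∷ [])
  detours 5 2 = three (9 ∷ 12 ∷ 0 ∷ []) (3 ∷ 1 ∷ 11 ∷ 8 ∷ []) (4 ∷ 13 ∷ 7 ∷ 6 ∷ [])
  detours 5 3 = three [] [ 9 ] (4 ∷ 13 ∷ 1 ∷ [])
  detours 5 4 = three [] (3 ∷ 1 ∷ 13 ∷ []) (9 ∷ 12 ∷ 0 ∷ 2 ∷ 6 ∷ 7 ∷ 10 ∷ [])
  detours 6 0 = three [ 2 ] (7 ∷ 13 ∷ []) (8 ∷ 11 ∷ 12 ∷ [])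
  detours 6 1 = three (7 ∷ 13 ∷ []) (8 ∷ 11 ∷ []) (2 ∷ 0 ∷ 14 ∷ [])
  detours 6 2 = three [] [ 8 ] (7 ∷ 13 ∷ 0 ∷ [])
  detours 6 3 = three (8 ∷ 11 ∷ 1 ∷ []) (2 ∷ 0 ∷ 12 ∷ 9 ∷ []) (7 ∷ 13 ∷ 4 ∷ 5 ∷ [])
  detours 6 4 = three (7 ∷ 10 ∷ []) (2 ∷ 0 ∷ 13 ∷ []) (8 ∷ 11 ∷ 1 ∷ 3 ∷ 5 ∷ [])
  detours 6 5 = three (7 ∷ 13 ∷ 4 ∷ []) (2 ∷ 0 ∷ 12 ∷ 9 ∷ []) (8 ∷ 11 ∷ 1 ∷ 3 ∷ [])
  detours 7 0 = three [ 13 ] (6 ∷ 2 ∷ []) (10 ∷ 4 ∷ 5 ∷ 9 ∷ 12 ∷ [])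
  detours 7 1 = three [ 13 ] (6 ∷ 8 ∷ 11 ∷ []) (10 ∷ 4 ∷ 5 ∷ 3 ∷ [])
  detours 7 2 = three [ 6 ] (13 ∷ 0 ∷ []) (10 ∷ 4 ∷ 5 ∷ 3 ∷ 1 ∷ 11 ∷ 8 ∷ [])
  detours 7 3 = three (13 ∷ 1 ∷ []) (10 ∷ 4 ∷ 5 ∷ []) (6 ∷ 2 ∷ 0 ∷ 12 ∷ 9 ∷ [])
  detours 7 4 = three [ 10 ] [ 13 ] (6 ∷ 8 ∷ 11 ∷ 1 ∷ 3 ∷ 5 ∷ [])
  detours 7 5 = three (10 ∷ 4 ∷ []) (13 ∷ 1 ∷ 3 ∷ []) (6 ∷ 2 ∷ 0 ∷ 12 ∷ 9 ∷ [])
  detours 7 6 = three [] (13 ∷ 0 ∷ 2 ∷ []) (10 ∷ 4 ∷ 5 ∷ 3 ∷ 1 ∷ 11 ∷ 8 ∷ [])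
  detours 8 0 = three [ 2 ] (11 ∷ 12 ∷ []) (6 ∷ 7 ∷ 13 ∷ [])
  detours 8 1 = three [ 11 ] (2 ∷ 0 ∷ 14 ∷ []) (6 ∷ 7 ∷ 13 ∷ [])
  detours 8 2 = three [] [ 6 ] (11 ∷ 12 ∷ 0 ∷ [])
  detours 8 3 = three (11 ∷ 1 ∷ []) (2 ∷ 0 ∷ 12 ∷ 9 ∷ []) (6 ∷ 7 ∷ 13 ∷ 4 ∷ 5 ∷ [])
  detours 8 4 = three (2 ∷ 0 ∷ 13 ∷ []) (6 ∷ 7 ∷ 10 ∷ []) (11 ∷ 1 ∷ 3 ∷ 5 ∷ [])
  detours 8 5 = three (11 ∷ 1 ∷ 3 ∷ []) (2 ∷ 0 ∷ 12 ∷ 9 ∷ []) (6 ∷ 7 ∷ 13 ∷ 4 ∷ [])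
  detours 8 6 = three [] [ 2 ] (11 ∷ 1 ∷ 13 ∷ 7 ∷ [])
  detours 8 7 = three [ 6 ] (2 ∷ 0 ∷ 13 ∷ []) (11 ∷ 1 ∷ 3 ∷ 5 ∷ 4 ∷ 10 ∷ [])
  detours 9 0 = three [ 12 ] (3 ∷ 1 ∷ 14 ∷ []) (5 ∷ 4 ∷ 13 ∷ [])
  detours 9 1 = three [ 3 ] (12 ∷ 11 ∷ []) (5 ∷ 4 ∷ 13 ∷ [])
  detours 9 2 = three (12 ∷ 0 ∷ []) (3 ∷ 1 ∷ 11 ∷ 8 ∷ []) (5 ∷ 4 ∷ 13 ∷ 7 ∷ 6 ∷ [])
  detours 9 3 = three [] [ 5 ] (12 ∷ 11 ∷ 1 ∷ [])
  detours 9 4 = three [ 5 ] (3 ∷ 1 ∷ 13 ∷ []) (12 ∷ 0 ∷ 2 ∷ 6 ∷ 7 ∷ 10 ∷ [])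
  detours 9 5 = three [] [ 3 ] (12 ∷ 0 ∷ 13 ∷ 4 ∷ [])
  detours 9 6 = three (12 ∷ 0 ∷ 2 ∷ []) (3 ∷ 1 ∷ 11 ∷ 8 ∷ []) (5 ∷ 4 ∷ 13 ∷ 7 ∷ [])
  detours 9 7 = three (3 ∷ 1 ∷ 13 ∷ []) (5 ∷ 4 ∷ 10 ∷ []) (12 ∷ 0 ∷ 2 ∷ 6 ∷ [])
  detours 9 8 = three (3 ∷ 1 ∷ 11 ∷ []) (12 ∷ 0 ∷ 2 ∷ []) (5 ∷ 4 ∷ 13 ∷ 7 ∷ 6 ∷ [])
  detours 10 0 = three [ 13 ] (7 ∷ 6 ∷ 2 ∷ []) (4 ∷ 5 ∷ 9 ∷ 12 ∷ [])
  detours 10 1 = three [ 13 ] (4 ∷ 5 ∷ 3 ∷ []) (7 ∷ 6 ∷ 8 ∷ 11 ∷ [])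
  detours 10 2 = three (7 ∷ 6 ∷ []) (13 ∷ 0 ∷ []) (4 ∷ 5 ∷ 3 ∷ 1 ∷ 11 ∷ 8 ∷ [])
  detours 10 3 = three (4 ∷ 5 ∷ []) (13 ∷ 1 ∷ []) (7 ∷ 6 ∷ 2 ∷ 0 ∷ 12 ∷ 9 ∷ [])
  detours 10 4 = three [] [ 13 ] (7 ∷ 6 ∷ 8 ∷ 11 ∷ 1 ∷ 3 ∷ 5 ∷ [])
  detours 10 5 = three [ 4 ] (13 ∷ 1 ∷ 3 ∷ []) (7 ∷ 6 ∷ 2 ∷ 0 ∷ 12 ∷ 9 ∷ [])
  detours 10 6 = three [ 7 ] (13 ∷ 0 ∷ 2 ∷ []) (4 ∷ 5 ∷ 3 ∷ 1 ∷ 11 ∷ 8 ∷ [])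
  detours 10 7 = three [] [ 13 ] (4 ∷ 5 ∷ 9 ∷ 12 ∷ 0 ∷ 2 ∷ 6 ∷ [])
  detours 10 8 = three (7 ∷ 6 ∷ []) (13 ∷ 0 ∷ 2 ∷ []) (4 ∷ 5 ∷ 3 ∷ 1 ∷ 11 ∷ [])
  detours 10 9 = three (4 ∷ 5 ∷ []) (13 ∷ 1 ∷ 3 ∷ []) (7 ∷ 6 ∷ 2 ∷ 0 ∷ 12 ∷ [])
  detours 11 0 = three [ 12 ] (1 ∷ 13 ∷ []) (8 ∷ 2 ∷ [])
  detours 11 1 = three [] (12 ∷ 9 ∷ 3 ∷ []) (8 ∷ 6 ∷ 7 ∷ 13 ∷ [])
  detours 11 2 = three [ 8 ] (12 ∷ 0 ∷ []) (1 ∷ 13 ∷ 7 ∷ 6 ∷ [])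
  detours 11 3 = three [ 1 ] (12 ∷ 9 ∷ []) (8 ∷ 6 ∷ 7 ∷ 13 ∷ 4 ∷ 5 ∷ [])
  detours 11 4 = three (1 ∷ 13 ∷ []) (12 ∷ 9 ∷ 5 ∷ []) (8 ∷ 6 ∷ 7 ∷ 10 ∷ [])
  detours 11 5 = three (1 ∷ 3 ∷ []) (12 ∷ 9 ∷ []) (8 ∷ 6 ∷ 7 ∷ 13 ∷ 4 ∷ [])
  detours 11 6 = three [ 8 ] (1 ∷ 13 ∷ 7 ∷ []) (12 ∷ 0 ∷ 2 ∷ [])
  detours 11 7 = three (1 ∷ 13 ∷ []) (8 ∷ 6 ∷ []) (12 ∷ 9 ∷ 5 ∷ 4 ∷ 10 ∷ [])
  detours 11 8 = three [] (12 ∷ 0 ∷ 2 ∷ []) (1 ∷ 13 ∷ 7 ∷ 6 ∷ [])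
  detours 11 9 = three [ 12 ] (1 ∷ 3 ∷ []) (8 ∷ 6 ∷ 7 ∷ 13 ∷ 4 ∷ 5 ∷ [])
  detours 11 10 = three (1 ∷ 13 ∷ []) (8 ∷ 6 ∷ 7 ∷ []) (12 ∷ 9 ∷ 5 ∷ 4 ∷ [])
  detours 12 0 = three [] (11 ∷ 8 ∷ 2 ∷ []) (9 ∷ 5 ∷ 4 ∷ 13 ∷ [])
  detours 12 1 = three [ 11 ] (0 ∷ 13 ∷ []) (9 ∷ 3 ∷ [])
  detours 12 2 = three [ 0 ] (11 ∷ 8 ∷ []) (9 ∷ 5 ∷ 4 ∷ 13 ∷ 7 ∷ 6 ∷ [])
  detours 12 3 = three [ 9 ] (11 ∷ 1 ∷ []) (0 ∷ 13 ∷ 4 ∷ 5 ∷ [])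
  detours 12 4 = three (0 ∷ 13 ∷ []) (9 ∷ 5 ∷ []) (11 ∷ 8 ∷ 6 ∷ 7 ∷ 10 ∷ [])
  detours 12 5 = three [ 9 ] (0 ∷ 13 ∷ 4 ∷ []) (11 ∷ 1 ∷ 3 ∷ [])
  detours 12 6 = three (0 ∷ 2 ∷ []) (11 ∷ 8 ∷ []) (9 ∷ 5 ∷ 4 ∷ 13 ∷ 7 ∷ [])
  detours 12 7 = three (0 ∷ 13 ∷ []) (11 ∷ 8 ∷ 6 ∷ []) (9 ∷ 5 ∷ 4 ∷ 10 ∷ [])
  detours 12 8 = three [ 11 ] (0 ∷ 2 ∷ []) (9 ∷ 5 ∷ 4 ∷ 13 ∷ 7 ∷ 6 ∷ [])
  detours 12 9 = three [] (11 ∷ 1 ∷ 3 ∷ []) (0 ∷ 13 ∷ 4 ∷ 5 ∷ [])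
  detours 12 10 = three (0 ∷ 13 ∷ []) (9 ∷ 5 ∷ 4 ∷ []) (11 ∷ 8 ∷ 6 ∷ 7 ∷ [])
  detours 12 11 = three [] (0 ∷ 2 ∷ 8 ∷ []) (9 ∷ 3 ∷ 1 ∷ [])
  detours 13 0 = three [] [ 14 ] (7 ∷ 6 ∷ 2 ∷ [])
  detours 13 1 = three [] [ 14 ] (4 ∷ 5 ∷ 3 ∷ [])
  detours 13 2 = three [ 0 ] (7 ∷ 6 ∷ []) (1 ∷ 11 ∷ 8 ∷ [])
  detours 13 3 = three [ 1 ] (4 ∷ 5 ∷ []) (0 ∷ 12 ∷ 9 ∷ [])
  detours 13 4 = three [] [ 10 ] (1 ∷ 3 ∷ 5 ∷ [])
  detours 13 5 = three [ 4 ] (1 ∷ 3 ∷ []) (0 ∷ 12 ∷ 9 ∷ [])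
  detours 13 6 = three [ 7 ] (0 ∷ 2 ∷ []) (1 ∷ 11 ∷ 8 ∷ [])
  detours 13 7 = three [] [ 10 ] (0 ∷ 2 ∷ 6 ∷ [])
  detours 13 8 = three (0 ∷ 2 ∷ []) (1 ∷ 11 ∷ []) (7 ∷ 6 ∷ [])
  detours 13 9 = three (0 ∷ 12 ∷ []) (1 ∷ 3 ∷ []) (4 ∷ 5 ∷ [])
  detours 13 10 = three [] [ 4 ] [ 7 ]
  detours 13 11 = three [ 1 ] (0 ∷ 12 ∷ []) (7 ∷ 6 ∷ 8 ∷ [])
  detours 13 12 = three [ 0 ] (1 ∷ 11 ∷ []) (4 ∷ 5 ∷ 9 ∷ [])
  detours _ _ = three [] [] []
  abstract
    -- The bound is 15 because some detours, such as one between the hubs, use the rim vertex 14.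
    -- Hence the family starts at order 15.
    gadget-routes : ∀ {u} → u < 14 → ∀ {v} → v < u → Routes 15 u v (detours u v)
    gadget-routes = toWitness {a? = allUpTo? (λ u → allUpTo? (λ v → routes? 15 u v (detours u v)) u) 14} _

  -- A fan from v to the hubs lies in 0, …, b, hence is disjoint from the rim beyond its vertex b.
  hub : ℕ → Fin 3 → ℕ
  hub b = lookup (0 ∷ 1 ∷ b ∷ [])

  record Fan (b v : ℕ) (P : Fin 3 → List ℕ) : Set where
    constructor mkFan
    field
      linked   : ∀ i → Linked Joined (P i ++ [ v ])
      unique   : ∀ i → Unique (P i ++ [ v ])
      bounded  : ∀ i → All (_≤ b) (P i ++ [ v ])
      separate : Separate P
      -- If v is itself the hub, `P i` is empty; appending v first covers this case.
      starts   : ∀ i → head (P i ++ [ v ]) ≡ just (hub b i)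

  fan? : ∀ b v P → Dec (Fan b v P)
  fan? b v P = map′ (λ (l , u , m , s , h) → mkFan l u m s h) (λ (mkFan l u m s h) → l , u , m , s , h)
    (Fin.all? (λ i → Linked.linked? joined? (P i ++ [ v ])) ×-dec
     Fin.all? (λ i → unique? (P i ++ [ v ])) ×-dec
     Fin.all? (λ i → All.all? (_≤? b) (P i ++ [ v ])) ×-dec
     separate? P ×-dec
     Fin.all? (λ i → Maybe.≡-dec _≟_ (head (P i ++ [ v ])) (just (hub b i))))

  abstract
    gadget-fans : ∀ {v} → v < 14 → Fan 13 v (fan v)
    gadget-fans = toWitness {a? = allUpTo? (λ v → fan? 13 v (fan v)) 14} _

  -- The rim vertices b + k, ..., b + 1, which lie strictly between 1 + b + k and b.
  descend : ℕ → ℕ → List ℕ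
  descend b k = applyDownFrom (suc b +_) k

  descend-linked : ∀ {b} k {xs} → 13 ≤ b → Linked Joined (b ∷ xs) →
                   Linked Joined (suc b + k ∷ descend b k ++ b ∷ xs)
  descend-linked {b} zero {xs} 13≤b ls =
    subst (λ m → Linked Joined (m ∷ b ∷ xs)) (sym (+-identityʳ (suc b))) (inj₂ (from-13 (λ u → Link u (suc u)) rim 13≤b) ∷ ls)
  descend-linked {b} (suc k) 13≤b ls =
    subst (λ m → Joined m (suc b + k)) (sym (+-suc (suc b) k))
      (inj₂ (from-13 (λ u → Link u (suc u)) rim (≤-trans 13≤b (≤-trans (n≤1+n b) (m≤m+n (suc b) k)))))
    ∷ descend-linked k 13≤b ls

  descend-unique : ∀ b k → Unique (suc b + k ∷ descend b k)
  descend-unique b k = Unique.applyDownFrom⁺₁ (suc b +_) (suc k) λ j<i _ eq →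
    <⇒≢ j<i (sym (+-cancelˡ-≡ (suc b) _ _ eq))

  descend-above : ∀ b k → All (b <_) (suc b + k ∷ descend b k)
  descend-above b k = All.applyDownFrom⁺₂ (suc b +_) (suc k) λ i → m≤m+n (suc b) i

  descend-below : ∀ b k → All (_< suc b + k) (descend b k)
  descend-below b k = All.applyDownFrom⁺₁ (suc b +_) k λ i<k → +-monoʳ-< (suc b) i<k

  disjoint-by : ∀ {b xs ys} → All (b <_) xs → All (_≤ b) ys → Disjoint xs ys
  disjoint-by above below (x∈xs , x∈ys) =
    <⇒≱ (All.lookup above x∈xs) (All.lookup below x∈ys)

  Disjoint-sym : ∀ {A : Set} {xs ys : List A} → Disjoint xs ys → Disjoint ys xs
  Disjoint-sym d (p , q) = d (q , p)

  -- Disjoint lists can only be equal if both are empty.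
  separate-by : ∀ {P Q : Fin 3 → List ℕ} →
                (∀ i → P i ≡ [] → Q i ≡ []) → Separate Q →
                (∀ i j → i ≢ j → Disjoint (P i) (P j)) → Separate P
  separate-by {P} {Q} empty sep disj i j i≢j = distinct , disj i j i≢j
    where
    nil : ∀ xs → Disjoint xs xs → xs ≡ []
    nil []       _ = refl
    nil (x ∷ xs) d = contradiction (here refl , here refl) d
    distinct : P i ≢ P j
    distinct Pi≡Pj = proj₁ (sep i j i≢j) (trans (empty i Pi≡[]) (sym (empty j (trans (sym Pi≡Pj) Pi≡[]))))
      where
      Pi≡[] : P i ≡ []
      Pi≡[] = nil (P i) (subst (Disjoint (P i)) (sym Pi≡Pj) (disj i j i≢j))

  Disjoint-++ : ∀ {A : Set} {ws xs ys zs : List A} → Disjoint ws ys → Disjoint ws zs →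
                Disjoint xs ys → Disjoint xs zs → Disjoint (ws ++ xs) (ys ++ zs)
  Disjoint-++ {ws = ws} {xs} {ys} {zs} wy wz xy xz (p , q) with ∈-++⁻ ws p | ∈-++⁻ ys q
  ... | inj₁ w | inj₁ y = wy (w , y)
  ... | inj₁ w | inj₂ z = wz (w , z)
  ... | inj₂ x | inj₁ y = xy (x , y)
  ... | inj₂ x | inj₂ z = xz (x , z)

  -- The vertex 1 + b + k reaches the starts of the fan by two spokes and by the walk down the rim.
  -- The walk stays above b and the fan does not, so the paths remain disjoint. All internal
  -- vertices are smaller than 1 + b + k, which therefore serves as the bound too.
  fan-routes : ∀ {b v F} k → 13 ≤ b → Fan b v F → ∃[ P ] Routes (suc b + k) (suc b + k) v P
  fan-routes {b} {v} {F} k 13≤b fan = P , routes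
    (λ i → route (subst (λ l → Linked Joined (u ∷ l)) (sym (List.++-assoc (D i) (F i) [ v ])) (linked′ i (linked i) (starts i)))
                 (subst (λ l → Unique (u ∷ l)) (sym (List.++-assoc (D i) (F i) [ v ]))
                   (Unique.++⁺ (unique′ i) (unique i) (disjoint-by (above i) (bounded i)))))
    (λ i → All.++⁺ (below i) (All.map (λ ≤b → ≤-<-trans ≤b (m≤m+n (suc b) k)) (low i)))
    (separate-by {P} {F} (λ i → List.++-conicalʳ (D i) (F i)) separate
      λ i j i≢j → Disjoint-++ (D-disjoint i j i≢j) (disjoint-by (All.tail (above i)) (low j))
        (Disjoint-sym (disjoint-by (All.tail (above j)) (low i))) (proj₂ (separate i j i≢j)))
    where
    open Fan fan
    u = suc b + k
    D P : Fin 3 → List ℕ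
    D = three [] [] (descend b k)
    P i = D i ++ F i

    low : ∀ i → All (_≤ b) (F i)
    low i = All.++⁻ˡ (F i) (bounded i)

    13≤u : 13 ≤ u
    13≤u = ≤-trans 13≤b (≤-trans (n≤1+n b) (m≤m+n (suc b) k))

    linked′ : ∀ i {xs} → Linked Joined xs → head xs ≡ just (hub b i) → Linked Joined (u ∷ D i ++ xs)
    linked′ zero             {_ ∷ _} l refl = inj₂ (from-13 (Link 0) spoke₀ 13≤u) ∷ l
    linked′ (suc zero)       {_ ∷ _} l refl = inj₂ (from-13 (Link 1) spoke₁ 13≤u) ∷ l
    linked′ (suc (suc zero)) {_ ∷ _} l refl = descend-linked k 13≤b l

    unique′ : ∀ i → Unique (u ∷ D i)
    unique′ zero             = [] ∷ []
    unique′ (suc zero)       = [] ∷ []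
    unique′ (suc (suc zero)) = descend-unique b k

    above : ∀ i → All (b <_) (u ∷ D i)
    above zero             = m≤m+n (suc b) k ∷ []
    above (suc zero)       = m≤m+n (suc b) k ∷ []
    above (suc (suc zero)) = descend-above b k

    below : ∀ i → All (_< u) (D i)
    below zero             = []
    below (suc zero)       = []
    below (suc (suc zero)) = descend-below b k

    D-disjoint : ∀ i j → i ≢ j → Disjoint (D i) (D j)
    D-disjoint zero             _                _ (() , _)
    D-disjoint (suc zero)       _                _ (() , _)
    D-disjoint (suc (suc zero)) zero             _ (_ , ())
    D-disjoint (suc (suc zero)) (suc zero)       _ (_ , ())
    D-disjoint (suc (suc zero)) (suc (suc zero)) i≢i _ = i≢i refl

  -- A rim vertex plays the part of the third hub itself, so its third list is empty.
  rim-fan : ∀ {v} → 13 ≤ v → Fan v v (three [ 0 ] [ 1 ] [])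
  rim-fan {v} 13≤v = record
    { linked   = λ { zero → inj₁ (from-13 (Link 0) spoke₀ 13≤v) ∷ [-]
                   ; (suc zero) → inj₁ (from-13 (Link 1) spoke₁ 13≤v) ∷ [-]
                   ; (suc (suc zero)) → [-] }
    ; unique   = λ { zero → (<⇒≢ (≤-trans (s≤s z≤n) 13≤v) ∷ []) ∷ [] ∷ []
                   ; (suc zero) → (<⇒≢ (≤-trans (s≤s (s≤s z≤n)) 13≤v) ∷ []) ∷ [] ∷ []
                   ; (suc (suc zero)) → [] ∷ [] }
    ; bounded  = λ { zero → z≤n ∷ ≤-refl ∷ []
                   ; (suc zero) → ≤-trans (s≤s z≤n) 13≤v ∷ ≤-refl ∷ []
                   ; (suc (suc zero)) → ≤-refl ∷ [] }
    ; separate = toWitness {a? = separate? (three [ 0 ] [ 1 ] [])} _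
    ; starts   = λ { zero → refl ; (suc zero) → refl ; (suc (suc zero)) → refl }
    }

  Routes-weaken : ∀ {m n u v P} → m ≤ n → Routes m u v P → Routes n u v P
  Routes-weaken m≤n (routes r b s) = routes r (λ i → All.map (λ <m → <-≤-trans <m m≤n) (b i)) s

  -- Explicit detours below 14; otherwise u lies on the rim beyond a fan from v, whose base b is 13
  -- if v < 14 and v itself if not.
  descending-routes : ∀ {n u v} → 15 ≤ n → v < u → u < n → ∃[ P ] Routes n u v P
  descending-routes {n} {u} {v} 15≤n v<u u<n with u <? 14 | v <? 14
  ... | yes u<14 | _        = detours u v , Routes-weaken 15≤n (gadget-routes u<14 v<u)
  ... | no  u≮14 | yes v<14 =
    let P , R = fan-routes (u ∸ 14) ≤-refl (gadget-fans v<14)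
    in P , Routes-weaken (<⇒≤ u<n) (subst (λ w → Routes w w v P) (m+[n∸m]≡n (≮⇒≥ u≮14)) R)
  ... | no  _    | no  v≮14 =
    let P , R = fan-routes (u ∸ suc v) 13≤v (rim-fan 13≤v)
    in P , Routes-weaken (<⇒≤ u<n) (subst (λ w → Routes w w v P) (m+[n∸m]≡n v<u) R)
    where
    13≤v = ≤-trans (n≤1+n 13) (≮⇒≥ v≮14)

  module _ {A : Set} {R : A → A → Set} where
    ʳ++-linked : (∀ {x y} → R x y → R y x) → ∀ {x y} xs {ys} →
                 Linked R (x ∷ xs) → Linked R (y ∷ ys) → R x y → Linked R ((x ∷ xs) ʳ++ (y ∷ ys))
    ʳ++-linked R-sym []       _        l r = r ∷ l
    ʳ++-linked R-sym (_ ∷ xs) (s ∷ l′) l r = ʳ++-linked R-sym xs l′ (r ∷ l) (R-sym s)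

    reverse-linked : (∀ {x y} → R x y → R y x) → ∀ {xs} → Linked R xs → Linked R (reverse xs)
    reverse-linked R-sym []      = []
    reverse-linked R-sym [-]     = [-]
    reverse-linked R-sym {_ ∷ _ ∷ xs} (r ∷ l) = ʳ++-linked R-sym xs l [-] (R-sym r)

  module _ {A : Set} where
    open SetoidPermutation (setoid A) using (Unique-resp-↭; ↭-reverse)
    open import Data.List.Relation.Binary.Permutation.Setoid (setoid A) using (↭-sym)

    reverse-unique : ∀ {xs : List A} → Unique xs → Unique (reverse xs)
    reverse-unique {xs} = Unique-resp-↭ (↭-sym (↭-reverse xs))

  reverse-path : ∀ {n} {G : Graph n} {u v} → Path G u v → Path G v u
  reverse-path {G = G} {u} {v} p = record
    { internal = reverse (internal p)
    ; linked   = subst (Linked (Adj G)) flip-ends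
                   (reverse-linked (λ {x} {y} → subst T (Graph.adj-sym G x y)) (Path.linked p))
    ; simple   = subst Unique flip-ends (reverse-unique (Path.simple p))
    }
    where
    flip-ends : reverse (u ∷ internal p ++ [ v ]) ≡ v ∷ reverse (internal p) ++ [ u ]
    flip-ends = trans (List.unfold-reverse u (internal p ++ [ v ]))
                  (cong (_++ [ u ]) (List.reverse-++ (internal p) [ v ]))

  -- Needed since routes are constructed only towards the smaller of the two vertices.
  DisjointPaths-sym : ∀ {k n} {G : Graph n} {u v} → DisjointPaths k G u v → DisjointPaths k G v u
  DisjointPaths-sym {G = G} (P , disj) = (λ i → reverse-path {G = G} (P i)) , λ i j i≢j →
    let distinct , disjoint = disj i j i≢j
    in (λ eq → distinct (List.reverse-injective eq)) , λ (p , q) → disjoint (reverse⁻ p , reverse⁻ q)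

  fin-list : ∀ {n} xs → All (_< n) xs → Σ[ ys ∈ List (Fin n) ] (map toℕ ys ≡ xs)
  fin-list []       []          = [] , refl
  fin-list (x ∷ xs) (x<n ∷ xs<n) = let ys , eq = fin-list xs xs<n in
    fromℕ< x<n ∷ ys , cong₂ _∷_ (Fin.toℕ-fromℕ< x<n) eq

  route⇒path : ∀ {n} {u v : Fin n} ys → Route (toℕ u) (toℕ v) (map toℕ ys) →
               Path (hubGraph n) u v
  route⇒path {n} {u} {v} ys (route l q) = record
    { internal = ys
    ; linked   = Linked.map (λ {x} {y} → T-does⁺ (joined? (toℕ x) (toℕ y)))
                   (Linked.map⁻ (subst (Linked Joined) ends l))
    ; simple   = Unique.map⁻ (subst Unique ends q)
    }
    where
    ends : toℕ u ∷ map toℕ ys ++ [ toℕ v ] ≡ map toℕ (u ∷ ys ++ [ v ])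
    ends = cong (toℕ u ∷_) (sym (List.map-++ toℕ ys [ v ]))

  routes⇒disjointPaths : ∀ {n P} {u v : Fin n} → Routes n (toℕ u) (toℕ v) P → DisjointPaths 3 (hubGraph n) u v
  routes⇒disjointPaths {n} {P} {u} {v} (routes routed bounded separate) =
    (λ i → route⇒path (proj₁ (fins i)) (subst (Route (toℕ u) (toℕ v)) (sym (lifted i)) (routed i))) , λ i j i≢j →
    let distinct , disjoint = separate i j i≢j in
    (λ eq → distinct (trans (sym (lifted i)) (trans (cong (map toℕ) eq) (lifted j)))) ,
    λ (p , q) → disjoint (subst (_ ∈_) (lifted i) (∈-map⁺ toℕ p) , subst (_ ∈_) (lifted j) (∈-map⁺ toℕ q))
    where
    fins : ∀ i → Σ[ ys ∈ List (Fin n) ] (map toℕ ys ≡ P i)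
    fins i = fin-list (P i) (bounded i)
    lifted : ∀ i → map toℕ (proj₁ (fins i)) ≡ P i
    lifted i = proj₂ (fins i)

  hubGraph-3-connected : ∀ {n} → 15 ≤ n → KConnected 3 (hubGraph n)
  hubGraph-3-connected {n} 15≤n = ≤-trans (s≤s (s≤s z≤n)) 15≤n , λ u v u≢v → disjointPaths u v u≢v
    where
    disjointPaths : ∀ u v → u ≢ v → DisjointPaths 3 (hubGraph n) u v
    disjointPaths u v u≢v with <-cmp (toℕ u) (toℕ v)
    ... | tri< u<v _ _ = DisjointPaths-sym {G = hubGraph n} (routes⇒disjointPaths (proj₂ (descending-routes 15≤n u<v (Fin.toℕ<n v))))
    ... | tri≈ _ u≡v _ = contradiction (Fin.toℕ-injective u≡v) u≢v
    ... | tri> _ _ v<u = routes⇒disjointPaths (proj₂ (descending-routes 15≤n v<u (Fin.toℕ<n u)))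

-- Separating lines for edges and vertices, over the integers.

module Separations where
  open import Data.Integer.Base as ℤ using (ℤ; +_; -[1+_])
  import Data.Integer.Properties as ℤ
  open import Data.Integer.Solver using (module +-*-Solver)
  open import Data.List.Base using (List; []; _∷_; map; _++_)
  open import Data.List.Membership.Propositional using (_∈_; find)
  open import Data.List.Relation.Unary.All as All using (All; []; _∷_)
  open import Data.List.Relation.Unary.Any as Any using (Any; here; there)
  open import Data.Nat.Base as ℕ using (ℕ; suc; _∸_)
  import Data.Nat.Coprimality as Coprime
  import Data.Nat.Properties as ℕ
  open import Data.Product.Base using (∃-syntax; _×_; _,_; proj₁; proj₂)
  import Data.Product.Base as Product
  import Data.Product.Properties as Product
  open import Data.Rational.Base as ℚ using (ℚ; mkℚ)
  import Data.Rational.Properties as ℚ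
  import Data.Rational.Unnormalised.Base as ℚᵘ
  import Data.Rational.Unnormalised.Properties as ℚᵘ
  open import Data.Sum.Base using (_⊎_; inj₁; inj₂; [_,_]′)
  open import Function.Base using (_∘_)
  open import Relation.Binary.Definitions using (tri<; tri≈; tri>)
  open import Relation.Binary.PropositionalEquality
    using (_≡_; _≢_; refl; sym; trans; cong; cong₂; subst; subst₂)
  open import Relation.Nullary.Decidable
    using (Dec; yes; no; map′; _×-dec_; _⊎-dec_; _→-dec_; ¬?; toWitness)
  open import Relation.Nullary.Negation using (contradiction)
  open +-*-Solver using (solve; _:=_; _:+_; _:*_; :-_; con)
  open Reals using (always)
  open Segments
  open Graphs

  open import Data.List.Membership.DecPropositional (Product.≡-dec _≟ᵉ_ _≟ᵉ_) using (_∈?_)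


  -- Given in lowest terms, so that numerator and denominator are visible even for a variable i, as
  -- the coordinates of the rim require.
  ι : ℤ → ℚ
  ι i = mkℚ i 0 (Coprime.sym (Coprime.1-coprimeTo ℤ.∣ i ∣))

  ι-+ : ∀ i j → ι (i ℤ.+ j) ≡ ι i ℚ.+ ι j
  ι-+ i j = ℚ.toℚᵘ-injective (ℚᵘ.≃-trans
    (ℚᵘ.*≡* (cong (ℤ._* + 1) (sym (cong₂ ℤ._+_ (ℤ.*-identityʳ i) (ℤ.*-identityʳ j)))))
    (ℚᵘ.≃-sym (ℚ.toℚᵘ-homo-+ (ι i) (ι j))))

  ι-* : ∀ i j → ι (i ℤ.* j) ≡ ι i ℚ.* ι j
  ι-* i j = ℚ.toℚᵘ-injective (ℚᵘ.≃-trans (ℚᵘ.*≡* refl) (ℚᵘ.≃-sym (ℚ.toℚᵘ-homo-* (ι i) (ι j))))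

  ι-mono-≤ : ∀ {i j} → i ℤ.≤ j → ι i ℚ.≤ ι j
  ι-mono-≤ i≤j = ℚ.*≤* (ℤ.*-monoʳ-≤-nonNeg (+ 1) i≤j)

  ι-mono-< : ∀ {i j} → i ℤ.< j → ι i ℚ.< ι j
  ι-mono-< i<j = ℚ.*<* (ℤ.*-monoʳ-<-pos (+ 1) i<j)

  ℤ² : Set
  ℤ² = ℤ × ℤ

  ι² : ℤ² → ℚ²
  ι² (x , y) = ι x , ι y

  infix 7 _∙_

  _∙_ : ℤ² → ℤ² → ℤ
  (a , b) ∙ (x , y) = a ℤ.* x ℤ.+ b ℤ.* y

  -- The integer form of `Separation`: decidable by evaluation on the fixed part of the drawing, and
  -- provable symbolically along the rim.
  record Splits (n : ℤ²) (γ : ℤ) (p q p′ q′ : ℤ²) : Set where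
    constructor splits
    field
      p≤     : n ∙ p ℤ.≤ γ
      q≤     : n ∙ q ℤ.≤ γ
      ≤p′    : γ ℤ.≤ n ∙ p′
      ≤q′    : γ ℤ.≤ n ∙ q′
      strict : n ∙ p ℤ.+ n ∙ q ℤ.< n ∙ p′ ℤ.+ n ∙ q′

  splits? : ∀ n γ p q p′ q′ → Dec (Splits n γ p q p′ q′)
  splits? n γ p q p′ q′ = map′ (λ (a , b , c , d , e) → splits a b c d e) (λ (splits a b c d e) → a , b , c , d , e)
    ((n ∙ p ℤ.≤? γ) ×-dec (n ∙ q ℤ.≤? γ) ×-dec (γ ℤ.≤? n ∙ p′) ×-dec (γ ℤ.≤? n ∙ q′) ×-dec
     (n ∙ p ℤ.+ n ∙ q ℤ.<? n ∙ p′ ℤ.+ n ∙ q′))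

  Split : (p q p′ q′ : ℤ²) → Set
  Split p q p′ q′ = ∃[ n ] ∃[ γ ] Splits n γ p q p′ q′

  split⇒separation : ∀ {p q p′ q′} → Split p q p′ q′ → Separation (ι² p) (ι² q) (ι² p′) (ι² q′)
  split⇒separation {p} {q} {p′} {q′} (n@(a , b) , γ , splits p≤ q≤ ≤p′ ≤q′ strict) = record
    { α = ι a ; β = ι b ; γ = ι γ
    ; p≤ = subst (ℚ._≤ ι γ) (value p) (ι-mono-≤ p≤)
    ; q≤ = subst (ℚ._≤ ι γ) (value q) (ι-mono-≤ q≤)
    ; ≤p′ = subst (ι γ ℚ.≤_) (value p′) (ι-mono-≤ ≤p′)
    ; ≤q′ = subst (ι γ ℚ.≤_) (value q′) (ι-mono-≤ ≤q′)
    ; strict = subst₂ ℚ._<_ (values p q) (values p′ q′) (ι-mono-< strict)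
    }
    where
    ℓ : ℤ² → ℚ
    ℓ (x , y) = ι a ℚ.* ι x ℚ.+ ι b ℚ.* ι y
    value : ∀ p → ι (n ∙ p) ≡ ℓ p
    value (x , y) = trans (ι-+ (a ℤ.* x) (b ℤ.* y)) (cong₂ ℚ._+_ (ι-* a x) (ι-* b y))
    values : ∀ p q → ι (n ∙ p ℤ.+ n ∙ q) ≡ ℓ p ℚ.+ ℓ q
    values p q = trans (ι-+ (n ∙ p) (n ∙ q)) (cong₂ ℚ._+_ (value p) (value q))

  -- Candidate normals.  Disjoint segments in general position are separated by a line through two
  -- of their ends; the axis directions serve degenerate segments, which stand for vertices.
  normals : (p q p′ q′ : ℤ²) → List ℤ²
  normals p q p′ q′ =
    map (perp (+ 0 , + 0)) axes ++ perp p q ∷ perp q p ∷ perp p′ q′ ∷ perp q′ p′ ∷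
    perp p p′ ∷ perp p′ p ∷ perp p q′ ∷ perp q′ p ∷ perp q p′ ∷ perp p′ q ∷ perp q q′ ∷ perp q′ q ∷ []
    where
    perp : ℤ² → ℤ² → ℤ²
    perp (x , y) (x′ , y′) = y ℤ.- y′ , x′ ℤ.- x
    axes = (+ 1 , + 0) ∷ (+ 0 , + 1) ∷ (-[1+ 0 ] , + 0) ∷ (+ 0 , -[1+ 0 ]) ∷ []

  -- For a given normal, the maximum is the least threshold that `p≤` and `q≤` allow; if any
  -- threshold works, this one does.
  SplitByCandidate : (p q p′ q′ : ℤ²) → Set
  SplitByCandidate p q p′ q′ = Any (λ n → Splits n (n ∙ p ℤ.⊔ n ∙ q) p q p′ q′) (normals p q p′ q′)

  splitByCandidate? : ∀ p q p′ q′ → Dec (SplitByCandidate p q p′ q′)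
  splitByCandidate? p q p′ q′ = Any.any? (λ n → splits? n (n ∙ p ℤ.⊔ n ∙ q) p q p′ q′) (normals p q p′ q′)

  candidate⇒split : ∀ {p q p′ q′} → SplitByCandidate p q p′ q′ → Split p q p′ q′
  candidate⇒split any = let n , _ , s = find any in n , _ , s

  -- The rim is the nonnegative part of the x-axis, and everything else lies to its left.
  position : ℕ → ℤ²
  position 0  = ℤ.- + 9 , + 6
  position 1  = ℤ.- + 9 , ℤ.- + 6
  position 2  = ℤ.- + 8 , ℤ.- + 2
  position 3  = ℤ.- + 8 , + 3
  position 4  = ℤ.- + 7 , ℤ.- + 3
  position 5  = ℤ.- + 7 , + 0
  position 6  = ℤ.- + 7 , + 1
  position 7  = ℤ.- + 7 , + 3
  position 8  = ℤ.- + 6 , + 0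
  position 9  = ℤ.- + 6 , + 1
  position 10 = ℤ.- + 5 , + 0
  position 11 = ℤ.- + 4 , ℤ.- + 1
  position 12 = ℤ.- + 4 , + 1
  position m  = + (m ∸ 13) , + 0

  crossings : List ((ℕ × ℕ) × (ℕ × ℕ))
  crossings = crossingPairs ++ map Product.swap crossingPairs

  Crossed : ℕ × ℕ → ℕ × ℕ → Set
  Crossed e f = (e , f) ∈ crossings

  crossed? : ∀ e f → Dec (Crossed e f)
  crossed? e f = (e , f) ∈? crossings

  abstract
    gadget-gadget : All (λ e@(u , v) → All (λ f@(u′ , v′) →
        e ≡ f ⊎ Crossed e f ⊎ SplitByCandidate (position u) (position v) (position u′) (position v′))
      gadgetEdges) gadgetEdges
    gadget-gadget = toWitness {a? = All.all? (λ e@(u , v) → All.all? (λ f@(u′ , v′) →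
        (e ≟ᵉ f) ⊎-dec crossed? e f ⊎-dec splitByCandidate? (position u) (position v) (position u′) (position v′))
      gadgetEdges) gadgetEdges} _

  abstract
    gadget-vertex : All (λ (u , v) → ∀ {m} → m ℕ.< 13 →
        SplitByCandidate (position u) (position v) (position m) (position m)) gadgetEdges
    gadget-vertex = toWitness {a? = All.all? (λ (u , v) →
        ℕ.allUpTo? (λ m → splitByCandidate? (position u) (position v) (position m) (position m)) 13) gadgetEdges} _

  abstract
    vertex-vertex : ∀ {l} → l ℕ.< 13 → ∀ {m} → m ℕ.< 13 → l ≢ m →
                    SplitByCandidate (position l) (position l) (position m) (position m)
    vertex-vertex = toWitness {a? = ℕ.allUpTo? (λ l → ℕ.allUpTo? (λ m → ¬? (l ℕ.≟ m) →-dec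
                      splitByCandidate? (position l) (position l) (position m) (position m)) 13) 13} _

  -- Normals of the lines through the rim vertex 13 (the origin) and the hub 0, resp. 1.
  north south east : ℤ²
  north = + 6 , + 9
  south = + 6 , ℤ.- + 9
  east  = + 1 , + 0

  Behind : ℤ² → ℤ² → ℤ² → Set
  Behind n p q = n ∙ p ℤ.≤ + 0 × n ∙ q ℤ.≤ + 0 × n ∙ p ℤ.+ n ∙ q ℤ.< + 0

  behind? : ∀ n p q → Dec (Behind n p q)
  behind? n p q = (n ∙ p ℤ.≤? + 0) ×-dec (n ∙ q ℤ.≤? + 0) ×-dec (n ∙ p ℤ.+ n ∙ q ℤ.<? + 0)

  abstract
    -- The hub 0 lies on the line of `north`, the hub 1 on that of `south`, and rim vertices have
    -- nonnegative value for all three normals. So this finite check separates the gadget edges from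
    -- all spokes and rim edges.
    gadget-behind : All (λ n → All (λ (u , v) → Behind n (position u) (position v)) gadgetEdges) (north ∷ south ∷ east ∷ [])
    gadget-behind = toWitness {a? = All.all? (λ n → All.all? (λ (u , v) → behind? n (position u) (position v)) gadgetEdges) (north ∷ south ∷ east ∷ [])} _

  behind⇒split : ∀ n {p q p′ q′} → Behind n p q → + 0 ℤ.≤ n ∙ p′ → + 0 ℤ.≤ n ∙ q′ → Split p q p′ q′
  behind⇒split n (p≤ , q≤ , <0) ≤p′ ≤q′ = n , + 0 , splits p≤ q≤ ≤p′ ≤q′ (ℤ.<-≤-trans <0 (ℤ.+-mono-≤ ≤p′ ≤q′))

  abstract
    vertex-behind : ∀ {m} → m ℕ.< 13 →
                    Behind east (position m) (position m) ×
                    (m ≢ 0 → Behind north (position m) (position m)) ×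
                    (m ≢ 1 → Behind south (position m) (position m))
    vertex-behind = toWitness {a? = ℕ.allUpTo? (λ m →
      behind? east (position m) (position m) ×-dec
      (¬? (m ℕ.≟ 0) →-dec behind? north (position m) (position m)) ×-dec
      (¬? (m ℕ.≟ 1) →-dec behind? south (position m) (position m))) 13} _

  rim-value : ∀ n k → n ∙ position (13 ℕ.+ k) ≡ proj₁ n ℤ.* + k
  rim-value (a , b) k = trans (cong (λ r → a ℤ.* + k ℤ.+ r) (ℤ.*-zeroʳ b)) (ℤ.+-identityʳ (a ℤ.* + k))

  east-rim : ∀ k → east ∙ position (13 ℕ.+ k) ≡ + k
  east-rim k = trans (rim-value east k) (ℤ.*-identityˡ (+ k))

  rim-nonneg : ∀ a b k → + 0 ℤ.≤ (+ a , b) ∙ position (13 ℕ.+ k)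
  rim-nonneg a b k = subst (+ 0 ℤ.≤_)
    (sym (trans (rim-value (+ a , b) k) (sym (ℤ.pos-* a k)))) (ℤ.+≤+ ℕ.z≤n)

  splits-by : ∀ {n γ p q p′ q′ a b c d} → n ∙ p ≡ a → n ∙ q ≡ b → n ∙ p′ ≡ c → n ∙ q′ ≡ d →
              a ℤ.≤ γ → b ℤ.≤ γ → γ ℤ.≤ c → γ ℤ.≤ d → a ℤ.+ b ℤ.< c ℤ.+ d → Splits n γ p q p′ q′
  splits-by refl refl refl refl = splits

  -- Segments on the x-axis are separated by a vertical line, here through the point j. The last
  -- hypothesis excludes that all four ends coincide.
  along-rim : ∀ i j k l → i ℕ.≤ j → j ℕ.≤ k → k ℕ.≤ l → i ℕ.+ j ℕ.< k ℕ.+ l →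
              Split (position (13 ℕ.+ i)) (position (13 ℕ.+ j)) (position (13 ℕ.+ k)) (position (13 ℕ.+ l))
  along-rim i j k l i≤j j≤k k≤l lt = east , + j ,
    splits-by (east-rim i) (east-rim j) (east-rim k) (east-rim l)
      (ℤ.+≤+ i≤j) ℤ.≤-refl (ℤ.+≤+ j≤k) (ℤ.+≤+ (ℕ.≤-trans j≤k k≤l)) (ℤ.+<+ lt)

  up : ℤ²
  up = + 0 , + 1

  up-rim : ∀ k → up ∙ position (13 ℕ.+ k) ≡ + 0
  up-rim k = trans (rim-value up k) (ℤ.*-zeroˡ (+ k))

  -- The x-axis itself separates. The height of the hub alone yields strictness, so i = j is
  -- possible and a single rim vertex is covered.
  above-rim : ∀ i j k → Split (position (13 ℕ.+ i)) (position (13 ℕ.+ j)) (position 0) (position (13 ℕ.+ k))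
  above-rim i j k = up , + 0 , splits-by (up-rim i) (up-rim j) refl (up-rim k)
    ℤ.≤-refl ℤ.≤-refl (ℤ.+≤+ ℕ.z≤n) ℤ.≤-refl (ℤ.+<+ (ℕ.s≤s ℕ.z≤n))

  below-rim : ∀ i j k → Split (position 1) (position (13 ℕ.+ k)) (position (13 ℕ.+ i)) (position (13 ℕ.+ j))
  below-rim i j k = up , + 0 , splits-by refl (up-rim k) (up-rim i) (up-rim j)
    ℤ.-≤+ ℤ.≤-refl ℤ.≤-refl ℤ.≤-refl ℤ.-<+

  below-above : ∀ j k → Split (position 1) (position (13 ℕ.+ j)) (position 0) (position (13 ℕ.+ k))
  below-above j k = up , + 0 , splits-by refl (up-rim j) refl (up-rim k)
    ℤ.-≤+ ℤ.≤-refl (ℤ.+≤+ ℕ.z≤n) ℤ.≤-refl ℤ.-<+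

  -- Separated by the line through the first spoke.
  spokes₀ : ∀ {j k} → j ℕ.< k → Split (position 0) (position (13 ℕ.+ j)) (position 0) (position (13 ℕ.+ k))
  spokes₀ {j} {k} j<k = n , γ , splits-by at-hub (rim-value n j) at-hub (rim-value n k)
    ℤ.≤-refl ℤ.≤-refl ℤ.≤-refl (ℤ.<⇒≤ γ<) (ℤ.+-monoʳ-< γ γ<)
    where
    γ = + 6 ℤ.* + j
    n = + 6 , + 9 ℤ.+ + j
    at-hub : n ∙ position 0 ≡ γ
    at-hub = solve 1 (λ j → con (+ 6) :* con (-[1+ 8 ]) :+ (con (+ 9) :+ j) :* con (+ 6) := con (+ 6) :* j) refl (+ j)
    γ< : γ ℤ.< + 6 ℤ.* + k
    γ< = ℤ.*-monoˡ-<-pos (+ 6) (ℤ.+<+ j<k)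

  spokes₁ : ∀ {j k} → j ℕ.< k → Split (position 1) (position (13 ℕ.+ j)) (position 1) (position (13 ℕ.+ k))
  spokes₁ {j} {k} j<k = n , γ , splits-by at-hub (rim-value n j) at-hub (rim-value n k)
    ℤ.≤-refl ℤ.≤-refl ℤ.≤-refl (ℤ.<⇒≤ γ<) (ℤ.+-monoʳ-< γ γ<)
    where
    γ = + 6 ℤ.* + j
    n = + 6 , ℤ.- (+ 9 ℤ.+ + j)
    at-hub : n ∙ position 1 ≡ γ
    at-hub = solve 1 (λ j → con (+ 6) :* con (-[1+ 8 ]) :+ (:- (con (+ 9) :+ j)) :* con (-[1+ 5 ]) := con (+ 6) :* j) refl (+ j)
    γ< : γ ℤ.< + 6 ℤ.* + k
    γ< = ℤ.*-monoˡ-<-pos (+ 6) (ℤ.+<+ j<k)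

  -- `Split` puts its first segment on the lower side of the normal, hence the two orders.
  Apart : (u v u′ v′ : ℕ) → Set
  Apart u v u′ v′ = Split (position u) (position v) (position u′) (position v′) ⊎
                    Split (position u′) (position v′) (position u) (position v)

  east-behind : ∀ {u v} → (u , v) ∈ gadgetEdges → Behind east (position u) (position v)
  east-behind = All.lookup (All.lookup gadget-behind (there (there (here refl))))

  gadget-spoke₀ : ∀ {u v} → (u , v) ∈ gadgetEdges → ∀ k →
                  Split (position u) (position v) (position 0) (position (13 ℕ.+ k))
  gadget-spoke₀ e k = behind⇒split north (All.lookup (All.lookup gadget-behind (here refl)) e)
    ℤ.≤-refl (rim-nonneg 6 (+ 9) k)

  gadget-spoke₁ : ∀ {u v} → (u , v) ∈ gadgetEdges → ∀ k →
                  Split (position u) (position v) (position 1) (position (13 ℕ.+ k))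
  gadget-spoke₁ e k = behind⇒split south (All.lookup (All.lookup gadget-behind (there (here refl))) e)
    ℤ.≤-refl (rim-nonneg 6 (ℤ.- + 9) k)

  gadget-rim : ∀ {u v} → (u , v) ∈ gadgetEdges → ∀ k →
               Split (position u) (position v) (position (13 ℕ.+ k)) (position (14 ℕ.+ k))
  gadget-rim e k = behind⇒split east (east-behind e) (rim-nonneg 1 (+ 0) k) (rim-nonneg 1 (+ 0) (suc k))

  rim-edges : ∀ {j k} → j ℕ.< k → Split (position (13 ℕ.+ j)) (position (14 ℕ.+ j)) (position (13 ℕ.+ k)) (position (14 ℕ.+ k))
  rim-edges {j} {k} j<k = along-rim j (suc j) k (suc k) (ℕ.n≤1+n j) j<k (ℕ.n≤1+n k) (ℕ.+-mono-< j<k (ℕ.s≤s j<k))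

  by-order : (P : ℕ → ℕ → Set) → (∀ {j k} → j ℕ.< k → P j k) →
             ∀ j k → j ≢ k → P j k ⊎ P k j
  by-order P p j k j≢k with ℕ.<-cmp j k
  ... | tri< j<k _ _ = inj₁ (p j<k)
  ... | tri≈ _ j≡k _ = contradiction j≡k j≢k
  ... | tri> _ _ k<j = inj₂ (p k<j)

  links-apart : ∀ {u v u′ v′} → Link u v → Link u′ v′ → (u , v) ≢ (u′ , v′) →
                Crossed (u , v) (u′ , v′) ⊎ Apart u v u′ v′
  links-apart (gadget e) (gadget f) e≢f =
    [ (λ e≡f → contradiction e≡f e≢f) , [ inj₁ , inj₂ ∘ inj₁ ∘ candidate⇒split ]′ ]′
      (All.lookup (All.lookup gadget-gadget e) f)
  links-apart (gadget e) (spoke₀ k) _ = inj₂ (inj₁ (gadget-spoke₀ e k))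
  links-apart (gadget e) (spoke₁ k) _ = inj₂ (inj₁ (gadget-spoke₁ e k))
  links-apart (gadget e) (rim k)    _ = inj₂ (inj₁ (gadget-rim e k))
  links-apart (spoke₀ k) (gadget e) _ = inj₂ (inj₂ (gadget-spoke₀ e k))
  links-apart (spoke₁ k) (gadget e) _ = inj₂ (inj₂ (gadget-spoke₁ e k))
  links-apart (rim k)    (gadget e) _ = inj₂ (inj₂ (gadget-rim e k))
  links-apart (spoke₀ j) (spoke₀ k) e≢f =
    inj₂ (by-order (λ j k → Split (position 0) (position (13 ℕ.+ j)) (position 0) (position (13 ℕ.+ k)))
      spokes₀ j k λ { refl → e≢f refl })
  links-apart (spoke₁ j) (spoke₁ k) e≢f =
    inj₂ (by-order (λ j k → Split (position 1) (position (13 ℕ.+ j)) (position 1) (position (13 ℕ.+ k)))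
      spokes₁ j k λ { refl → e≢f refl })
  links-apart (spoke₀ j) (spoke₁ k) _ = inj₂ (inj₂ (below-above k j))
  links-apart (spoke₁ j) (spoke₀ k) _ = inj₂ (inj₁ (below-above j k))
  links-apart (spoke₀ k) (rim j)    _ = inj₂ (inj₂ (above-rim j (suc j) k))
  links-apart (rim j)    (spoke₀ k) _ = inj₂ (inj₁ (above-rim j (suc j) k))
  links-apart (spoke₁ k) (rim j)    _ = inj₂ (inj₁ (below-rim j (suc j) k))
  links-apart (rim j)    (spoke₁ k) _ = inj₂ (inj₂ (below-rim j (suc j) k))
  links-apart (rim j)    (rim k)    e≢f =
    inj₂ (by-order (λ j k → Split (position (13 ℕ.+ j)) (position (14 ℕ.+ j)) (position (13 ℕ.+ k)) (position (14 ℕ.+ k)))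
      rim-edges j k λ { refl → e≢f refl })

  data Vertex : ℕ → Set where
    inner : ∀ {m} → m ℕ.< 13 → Vertex m
    outer : ∀ k → Vertex (13 ℕ.+ k)

  vertex : ∀ m → Vertex m
  vertex m with m ℕ.<? 13
  ... | yes m<13 = inner m<13
  ... | no  m≮13 = from-13 Vertex outer (ℕ.≮⇒≥ m≮13)

  inner-rim : ∀ {m} → m ℕ.< 13 → ∀ j k → Split (position m) (position m) (position (13 ℕ.+ j)) (position (13 ℕ.+ k))
  inner-rim m<13 j k = behind⇒split east (proj₁ (vertex-behind m<13)) (rim-nonneg 1 (+ 0) j) (rim-nonneg 1 (+ 0) k)

  -- The hub 0 lies on the line of `north`, which therefore cannot separate it from its own spokes.
  -- The horizontal line through the hub does: the rim end of the spoke is strictly below it.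
  inner-spoke₀ : ∀ {m} → m ℕ.< 13 → Dec (m ≡ 0) → ∀ k → Apart 0 (13 ℕ.+ k) m m
  inner-spoke₀ m<13 (yes refl) k = inj₁ (up , + 6 , splits-by refl (up-rim k) refl refl
    ℤ.≤-refl (ℤ.+≤+ ℕ.z≤n) ℤ.≤-refl ℤ.≤-refl (ℤ.+<+ (ℕ.m≤m+n 7 5)))
  inner-spoke₀ m<13 (no m≢0)   k =
    inj₂ (behind⇒split north (proj₁ (proj₂ (vertex-behind m<13)) m≢0) ℤ.≤-refl (rim-nonneg 6 (+ 9) k))

  inner-spoke₁ : ∀ {m} → m ℕ.< 13 → Dec (m ≡ 1) → ∀ k → Apart 1 (13 ℕ.+ k) m m
  inner-spoke₁ m<13 (yes refl) k = inj₂ (up , -[1+ 5 ] , splits-by refl refl refl (up-rim k)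
    ℤ.≤-refl ℤ.≤-refl ℤ.≤-refl ℤ.-≤+ (ℤ.-<- (ℕ.m≤m+n 6 5)))
  inner-spoke₁ m<13 (no m≢1)   k =
    inj₂ (behind⇒split south (proj₂ (proj₂ (vertex-behind m<13)) m≢1) ℤ.≤-refl (rim-nonneg 6 (ℤ.- + 9) k))

  outer-rim : ∀ i k → Dec (i ℕ.≤ k) → Apart (13 ℕ.+ k) (14 ℕ.+ k) (13 ℕ.+ i) (13 ℕ.+ i)
  outer-rim i k (yes i≤k) = inj₂ (along-rim i i k (suc k) ℕ.≤-refl i≤k (ℕ.n≤1+n k) (ℕ.+-mono-≤-< i≤k (ℕ.s≤s i≤k)))
  outer-rim i k (no  i≰k) = inj₁ (along-rim k (suc k) i i (ℕ.n≤1+n k) (ℕ.≰⇒> i≰k) ℕ.≤-refl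
                              (ℕ.+-mono-<-≤ (ℕ.≰⇒> i≰k) (ℕ.≰⇒> i≰k)))

  vertex-apart : ∀ {u v m} → Link u v → Vertex m → Apart u v m m
  vertex-apart (gadget e) (inner m<13)     = inj₁ (candidate⇒split (All.lookup gadget-vertex e m<13))
  vertex-apart (gadget e) (outer i)        = inj₁ (behind⇒split east (east-behind e) (rim-nonneg 1 (+ 0) i) (rim-nonneg 1 (+ 0) i))
  vertex-apart (spoke₀ k) (inner {m} m<13) = inner-spoke₀ m<13 (m ℕ.≟ 0) k
  vertex-apart (spoke₀ k) (outer i)        = inj₂ (above-rim i i k)
  vertex-apart (spoke₁ k) (inner {m} m<13) = inner-spoke₁ m<13 (m ℕ.≟ 1) k
  vertex-apart (spoke₁ k) (outer i)        = inj₁ (below-rim i i k)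
  vertex-apart (rim k)    (inner m<13)     = inj₂ (inner-rim m<13 k (suc k))
  vertex-apart (rim k)    (outer i)        = outer-rim i k (i ℕ.≤? k)

  vertices-apart : ∀ {l m} → Vertex l → Vertex m → l ≢ m → Apart l l m m
  vertices-apart (inner l<13) (inner m<13) l≢m = inj₁ (candidate⇒split (vertex-vertex l<13 m<13 l≢m))
  vertices-apart (inner l<13) (outer k)    _   = inj₁ (inner-rim l<13 k k)
  vertices-apart (outer k)    (inner m<13) _   = inj₂ (inner-rim m<13 k k)
  vertices-apart (outer j)    (outer k)    l≢m =
    by-order (λ j k → Split (position (13 ℕ.+ j)) (position (13 ℕ.+ j)) (position (13 ℕ.+ k)) (position (13 ℕ.+ k)))
      (λ {j} {k} j<k → along-rim j j k k ℕ.≤-refl (ℕ.<⇒≤ j<k) ℕ.≤-refl (ℕ.+-mono-< j<k j<k))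
      j k λ { refl → l≢m refl }

-- The straight-line drawing and its crossings.

module Drawings where
  open import Data.Bool.Properties using (T-irrelevant)
  open import Data.Empty using (⊥)
  open import Data.Fin.Base as Fin using (Fin; toℕ)
  import Data.Fin.Properties as Fin
  open import Data.Integer.Base using (+_; -[1+_])
  open import Data.List.Relation.Unary.All as All using (All)
  open import Data.Nat.Base as ℕ using (ℕ; suc)
  import Data.Nat.Properties as ℕ
  open import Data.Product.Base using (_×_; _,_; proj₁; proj₂)
  import Data.Product.Properties as Product
  open import Data.Rational.Base as ℚ using (ℚ; mkℚ; 0ℚ; 1ℚ; ½)
  import Data.Rational.Properties as ℚ
  open import Data.Rational.Solver using (module +-*-Solver)
  open import Data.Sum.Base using (inj₁; inj₂; [_,_]′)
  open import Relation.Binary.PropositionalEquality using (_≡_; _≢_; refl; cong; cong₂; subst)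
  open import Relation.Nullary.Decidable using (Dec; _×-dec_; _→-dec_; ¬?; toWitness)
  open import Relation.Nullary.Negation using (¬_; contradiction)
  open +-*-Solver using (solve; _:=_; _:+_; _:*_; _:-_; con)
  open Reals using (always; ≗⇒≈)
  open Segments
  open Graphs
  open Separations

  place : ℕ → ℚ²
  place m = ι² (position m)

  -- Junk value: 0 for 0.
  reciprocal : ℚ → ℚ
  reciprocal (mkℚ (+ 0)       _ _) = 0ℚ
  reciprocal (mkℚ (+ (suc n)) d _) = + suc d ℚ./ suc n
  reciprocal (mkℚ -[1+ n ]    d _) = -[1+ d ] ℚ./ suc n

  -- No crossing divides an edge in a ratio more uneven than 1 : 7.
  ⅛ : ℚ
  ⅛ = + 1 ℚ./ 8

  -- Cramer's rule for p + s (q - p) = p′ + t (q′ - p′); the factor 64 in k is ⅛ to the power -2.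
  module Intersection (p q p′ q′ : ℚ²) where
    d⁻¹ = reciprocal (det (q ⊖ p) (q′ ⊖ p′))
    s = det (p′ ⊖ p) (q′ ⊖ p′) ℚ.* d⁻¹
    t = det (p′ ⊖ p) (q ⊖ p) ℚ.* d⁻¹
    k = (+ 64 ℚ./ 1) ℚ.* d⁻¹

    Valid : Set
    Valid = ⅛ ℚ.≤ s × s ℚ.+ ⅛ ℚ.≤ 1ℚ × ⅛ ℚ.≤ t × t ℚ.+ ⅛ ℚ.≤ 1ℚ ×
            p ⟨ s ⟩ q ≡ p′ ⟨ t ⟩ q′ × k ℚ.* det (⅛ ⊙ (q ⊖ p)) (⅛ ⊙ (q′ ⊖ p′)) ≡ 1ℚ

    valid? : Dec Valid
    valid? = (⅛ ℚ.≤? s) ×-dec (s ℚ.+ ⅛ ℚ.≤? 1ℚ) ×-dec (⅛ ℚ.≤? t) ×-dec (t ℚ.+ ⅛ ℚ.≤? 1ℚ) ×-dec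
             Product.≡-dec ℚ._≟_ ℚ._≟_ (p ⟨ s ⟩ q) (p′ ⟨ t ⟩ q′) ×-dec
             (k ℚ.* det (⅛ ⊙ (q ⊖ p)) (⅛ ⊙ (q′ ⊖ p′)) ℚ.≟ 1ℚ)

    crossing : Valid → Crossing p q p′ q′
    crossing (s₀ , s₁ , t₀ , t₁ , m , k-det) = record
      { s = s ; t = t ; ε = ⅛ ; k = k ; 0<ε = ℚ.positive⁻¹ ⅛
      ; ε≤s = s₀ ; s+ε≤1 = s₁ ; ε≤t = t₀ ; t+ε≤1 = t₁ ; meet = m ; k-det = k-det }

  abstract
    crossings-valid : All (λ ((u , v) , (u′ , v′)) →
      Intersection.Valid (place u) (place v) (place u′) (place v′)) crossings
    crossings-valid = toWitness {a? = All.all? (λ ((u , v) , (u′ , v′)) →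
      Intersection.valid? (place u) (place v) (place u′) (place v′)) crossings} _

  abstract
    -- The combinatorial half of `crossed-once`; the geometric half, a single common point, is
    -- `meet-unique`.
    partner-unique : All (λ (e , f) → All (λ (e′ , g) → e ≡ e′ → f ≡ g) crossings) crossings
    partner-unique = toWitness {a? = All.all? (λ (e , f) → All.all? (λ (e′ , g) →
      (e ≟ᵉ e′) →-dec (f ≟ᵉ g)) crossings) crossings} _

  abstract
    partners-nonadjacent : All (λ ((u , v) , (u′ , v′)) → u ≢ u′ × u ≢ v′ × v ≢ u′ × v ≢ v′) crossings
    partners-nonadjacent = toWitness {a? = All.all? (λ ((u , v) , (u′ , v′)) →
      ¬? (u ℕ.≟ u′) ×-dec ¬? (u ℕ.≟ v′) ×-dec ¬? (v ℕ.≟ u′) ×-dec ¬? (v ℕ.≟ v′)) crossings} _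

  crossing-of : ∀ {u v u′ v′} → Crossed (u , v) (u′ , v′) → Crossing (place u) (place v) (place u′) (place v′)
  crossing-of {u} {v} {u′} {v′} c =
    Intersection.crossing (place u) (place v) (place u′) (place v′) (All.lookup crossings-valid c)

  disjoint-interiors : ∀ {u v u′ v′} → Apart u v u′ v′ → ∀ s t → Inside s → Inside t →
                       ¬ (segment (place u) (place v) s ≈ᵖ segment (place u′) (place v′) t)
  disjoint-interiors (inj₁ S) s t in-s in-t h = separated (split⇒separation S) s t in-s in-t h
  disjoint-interiors {u} {v} {u′} {v′} (inj₂ S) s t in-s in-t h =
    separated (split⇒separation S) t s in-t in-s
      (≈ᵖ-sym {segment (place u) (place v) s} {segment (place u′) (place v′) t} h)

  ½ʳ : ℝ
  ½ʳ = fromℚ ½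

  inside-½ : Inside ½ʳ
  inside-½ = (½ , ℚ.positive⁻¹ ½ , always λ _ → ℚ.≤-refl) , (½ , ℚ.positive⁻¹ ½ , always λ _ → ℚ.≤-refl)

  -- A vertex counts as a degenerate segment with the interior parameter ½, so that
  -- `disjoint-interiors` also keeps vertices apart from edges and from each other.
  degenerate : ∀ p t → segment p p t ≈ᵖ ⌜ p ⌝
  degenerate (x , y) t =
    ≗⇒≈ {proj₁ (segment (x , y) (x , y) t)} {fromℚ x} (λ n → collapse x (seq t n)) ,
    ≗⇒≈ {proj₂ (segment (x , y) (x , y) t)} {fromℚ y} (λ n → collapse y (seq t n))
    where
    collapse : ∀ x t → (x ℚ.- x) ℚ.* t ℚ.+ 0ℚ ℚ.* t ℚ.+ x ≡ x
    collapse = solve 2 (λ x t → (x :- x) :* t :+ con 0ℚ :* t :+ x := x) refl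

  distinct-points : ∀ {l m} → l ≢ m → ¬ (⌜ place l ⌝ ≈ᵖ ⌜ place m ⌝)
  distinct-points {l} {m} l≢m h =
    disjoint-interiors (vertices-apart (vertex l) (vertex m) l≢m) ½ʳ ½ʳ inside-½ inside-½
      (≈ᵖ-trans {segment (place l) (place l) ½ʳ} {⌜ place l ⌝} {segment (place m) (place m) ½ʳ}
        (degenerate (place l) ½ʳ)
        (≈ᵖ-trans {⌜ place l ⌝} {⌜ place m ⌝} {segment (place m) (place m) ½ʳ} h
          (≈ᵖ-sym {segment (place m) (place m) ½ʳ} {⌜ place m ⌝} (degenerate (place m) ½ʳ))))

  module _ {n : ℕ} where
    ends : Edge (hubGraph n) → ℕ × ℕ
    ends e = toℕ (src e) , toℕ (tgt e)

    link : (e : Edge (hubGraph n)) → Link (toℕ (src e)) (toℕ (tgt e))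
    link e with T-does⁻ (joined? (toℕ (src e)) (toℕ (tgt e))) (adjacent e)
    ... | inj₁ l = l
    ... | inj₂ l = contradiction (link⇒< l) (ℕ.<-asym (src<tgt e))

    ends-injective : ∀ e f → ends e ≡ ends f → e ≡ f
    ends-injective (edge u v u<v uv) (edge u′ v′ u′<v′ uv′) eq
      with Fin.toℕ-injective (cong proj₁ eq) | Fin.toℕ-injective (cong proj₂ eq)
    ... | refl | refl = cong₂ (edge u v) (ℕ.<-irrelevant u<v u′<v′) (T-irrelevant uv uv′)

    ends-distinct : (e : Edge (hubGraph n)) → place (toℕ (src e)) ≢ place (toℕ (tgt e))
    ends-distinct e eq = distinct-points (ℕ.<⇒≢ (src<tgt e))
      (subst (λ p → ⌜ place (toℕ (src e)) ⌝ ≈ᵖ ⌜ p ⌝) eq (≈ᵖ-refl {⌜ place (toℕ (src e)) ⌝}))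

    edgeArc : (e : Edge (hubGraph n)) → Arc ⌜ place (toℕ (src e)) ⌝ ⌜ place (toℕ (tgt e)) ⌝
    edgeArc e = segmentArc (place (toℕ (src e))) (place (toℕ (tgt e))) (ends-distinct e)

    interiors-cross : ∀ e f → e ≢ f → ∀ x → InInterior (edgeArc e) x → InInterior (edgeArc f) x →
                      Crossed (ends e) (ends f)
    interiors-cross e f e≢f x ((s , _) , 0<s , s<1 , hs) ((t , _) , 0<t , t<1 , ht) =
      [ (λ c → c) , (λ apart → contradiction
          (≈ᵖ-trans {σ} {x} {τ} hs (≈ᵖ-sym {τ} {x} ht))
          (disjoint-interiors apart s t (0<s , s<1) (0<t , t<1))) ]′
        (links-apart (link e) (link f) λ eq → e≢f (ends-injective e f eq))
      where
      σ = segment (place (toℕ (src e))) (place (toℕ (tgt e))) s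
      τ = segment (place (toℕ (src f))) (place (toℕ (tgt f))) t

    straight : Drawing (hubGraph n)
    straight = record
      { pos          = λ v → ⌜ place (toℕ v) ⌝
      ; pos-distinct = λ u v u≢v → distinct-points λ eq → u≢v (Fin.toℕ-injective eq)
      ; arc          = edgeArc
      ; avoids       = λ e v ((t , _) , 0<t , t<1 , h) →
          let p = place (toℕ v)
              τ = segment (place (toℕ (src e))) (place (toℕ (tgt e))) t
          in disjoint-interiors (vertex-apart (link e) (vertex (toℕ v))) t ½ʳ (0<t , t<1) inside-½
               (≈ᵖ-trans {τ} {⌜ p ⌝} {segment p p ½ʳ} h (≈ᵖ-sym {segment p p ½ʳ} {⌜ p ⌝} (degenerate p ½ʳ)))
      ; no-tangency  = λ e f e≢f x in-e in-f →
          crossAt (ends-distinct e) (ends-distinct f) (crossing-of (interiors-cross e f e≢f x in-e in-f)) x in-e in-f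
      }

    open Drawing straight using (CrossesAt; Crosses)

    crosses⇒crossed : ∀ e f x → CrossesAt e f x → Crossed (ends e) (ends f)
    crosses⇒crossed e f x (e≢f , in-e , in-f , _) = interiors-cross e f e≢f x in-e in-f

    crossed⇒crosses : ∀ e f → Crossed (ends e) (ends f) → Crosses e f
    crossed⇒crosses e f c =
      let x , at = crosses (ends-distinct e) (ends-distinct f) (crossing-of c)
      -- Partners have no common end, so no edge is its own partner.
      in x , (λ { refl → proj₁ (All.lookup partners-nonadjacent c) refl }) , at

    straight-1-plane : Is1Plane straight
    straight-1-plane = record
      { crossed-once = λ e f g x y e×f e×g →
          same-point e f g x y e×f e×g
            (ends-injective f g (All.lookup (All.lookup partner-unique (crosses⇒crossed e f x e×f)) (crosses⇒crossed e g y e×g) refl))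
      ; non-adjacent = λ e f (x , e×f) (v , in-e , in-f) →
          no-common-end e f v (All.lookup partners-nonadjacent (crosses⇒crossed e f x e×f)) in-e in-f
      }
      where
      on : ∀ e x → InInterior (edgeArc e) x → OnArc (edgeArc e) x
      on e x (t , _ , _ , h) = t , h
      same-point : ∀ e f g x y → CrossesAt e f x → CrossesAt e g y → f ≡ g → f ≡ g × x ≈ᵖ y
      same-point e f .f x y e×f@(_ , x-e , x-f , _) (_ , y-e , y-f , _) refl = refl ,
        ≈ᵖ-trans {x} {⌜ c ⌝} {y} (unique x (on e x x-e) (on f x x-f))
          (≈ᵖ-sym {y} {⌜ c ⌝} (unique y (on e y y-e) (on f y y-f)))
        where
        C = crossing-of (crosses⇒crossed e f x e×f)
        c = place (toℕ (src e)) ⟨ Crossing.s C ⟩ place (toℕ (tgt e))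
        unique = meet-unique (ends-distinct e) (ends-distinct f) C
      no-common-end : ∀ e f v → let u , w = ends e ; u′ , w′ = ends f in
                      u ≢ u′ × u ≢ w′ × w ≢ u′ × w ≢ w′ → Incident v e → Incident v f → ⊥
      no-common-end e f v (h , _) (inj₁ refl) (inj₁ eq) = h (cong toℕ eq)
      no-common-end e f v (_ , h , _) (inj₁ refl) (inj₂ eq) = h (cong toℕ eq)
      no-common-end e f v (_ , _ , h , _) (inj₂ refl) (inj₁ eq) = h (cong toℕ eq)
      no-common-end e f v (_ , _ , _ , h) (inj₂ refl) (inj₂ eq) = h (cong toℕ eq)

-- No plane spanning subgraph is connected.

module Obstruction where
  open import Data.Bool.Base using (Bool; true; false; T; if_then_else_)
  open import Data.Empty using (⊥)
  open import Data.Fin.Base as Fin using (Fin; toℕ)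
  import Data.Fin.Properties as Fin
  open import Data.List.Base
    using (List; []; _∷_; [_]; map; _++_; length; filter; applyUpTo; concatMap)
  import Data.List.Properties as List
  open import Data.List.Membership.Propositional using (_∈_)
  open import Data.List.Membership.Propositional.Properties using (∈-map⁺; ∈-++⁺ˡ)
  open import Data.List.Relation.Unary.All as All using (All; []; _∷_)
  import Data.List.Relation.Unary.All.Properties as All
  open import Data.List.Relation.Unary.AllPairs using ([]; _∷_)
  open import Data.List.Relation.Unary.Any using (here; there)
  open import Data.List.Relation.Unary.Linked using (Linked; []; _∷_)
  open import Data.List.Relation.Unary.Unique.Propositional using (Unique)
  import Data.List.Relation.Unary.Unique.Propositional.Properties as Unique
  open import Data.Nat.Base as ℕ using (ℕ; suc; _+_; _≤_; _<_; z≤n; s≤s; s≤s⁻¹)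
  import Data.Nat.Properties as ℕ
  open import Data.Nat.DivMod using (_mod_; m<n⇒m%n≡m)
  open import Data.Product.Base using (∃-syntax; _×_; _,_; proj₁; proj₂)
  open import Data.Sum.Base as Sum using (_⊎_; inj₁; inj₂)
  open import Relation.Binary.Definitions using (DecidableEquality)
  open import Relation.Binary.PropositionalEquality
    using (_≡_; _≢_; refl; sym; trans; cong; cong₂; subst; subst₂)
  open import Relation.Nullary.Decidable using (does; yes; no; _×-dec_; ¬?; toWitness)
  open import Relation.Nullary.Negation using (¬_; contradiction)
  open Graphs
  open Separations
  open Drawings

  -- Merging the colours of the ends of an edge removes at most one colour, so m edges
  -- cannot merge m + 2 colours into one.
  module _ {V C : Set} (_≟ᶜ_ : DecidableEquality C) (P : V → Set) where

    -- V will be all of ℕ; `P` confines the witnesses to vertices that every graph of the family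
    -- has, so that a path must join them.
    Attained : (V → C) → C → Set
    Attained f c = ∃[ x ] (P x × f x ≡ c)

    recolour : C → C → C → C
    recolour c d e = if does (e ≟ᶜ d) then c else e

    recolour-≡ : ∀ c d → recolour c d d ≡ c
    recolour-≡ c d with d ≟ᶜ d
    ... | yes _  = refl
    ... | no d≢d = contradiction refl d≢d

    recolour-≢ : ∀ c d {e} → e ≢ d → recolour c d e ≡ e
    recolour-≢ c d {e} e≢d with e ≟ᶜ d
    ... | yes e≡d = contradiction e≡d e≢d
    ... | no _    = refl

    recolour-target : ∀ c d → recolour c d c ≡ c
    recolour-target c d with c ≟ᶜ d
    ... | yes _ = refl
    ... | no _  = refl

    length-delete : ∀ d {cs} → Unique cs → length cs ≤ suc (length (filter (λ c → ¬? (c ≟ᶜ d)) cs))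
    length-delete d {[]} _ = z≤n
    length-delete d {c ∷ cs} (c∉cs ∷ u) with c ≟ᶜ d
    ... | yes refl = s≤s (ℕ.≤-reflexive (cong length (sym (List.filter-all (λ c → ¬? (c ≟ᶜ d))
                       (All.map (λ c≢e e≡c → c≢e (sym e≡c)) c∉cs)))))
    ... | no  _    = s≤s (length-delete d u)

    colour-merging : ∀ (es : List (V × V)) (f : V → C) cs →
      2 + length es ≤ length cs → Unique cs → All (Attained f) cs →
      Σ[ g ∈ (V → C) ] ((∀ x y → f x ≡ f y → g x ≡ g y) ×
                        All (λ (x , y) → g x ≡ g y) es ×
                        Σ[ x ∈ V ] Σ[ y ∈ V ] (P x × P y × g x ≢ g y))
    colour-merging [] f (c ∷ d ∷ cs) _ ((c≢d ∷ _) ∷ _) ((x , px , fx≡c) ∷ (y , py , fy≡d) ∷ _) =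
      f , (λ _ _ eq → eq) , [] , x , y , px , py , λ eq → c≢d (trans (sym fx≡c) (trans eq fy≡d))
    colour-merging [] f (c ∷ []) (s≤s ()) _ _
    colour-merging ((x , y) ∷ es) f cs enough unique attained =
      let g , coarser , merged , distinct = colour-merging es f′ cs′
            -- Since the listed colours are distinct, deleting the colour f y costs at most one
            -- entry, which the edge (x , y) pays for.
            (s≤s⁻¹ (ℕ.≤-trans enough (length-delete (f y) unique)))
            (Unique.filter⁺ keep? unique)
            (still-attained cs attained)
      in g , (λ a b eq → coarser a b (cong (recolour (f x) (f y)) eq)) ,
         -- `f′` already agrees on x and y, and `g` is coarser than `f′`.
         coarser x y (trans (recolour-target (f x) (f y)) (sym (recolour-≡ (f x) (f y)))) ∷ merged ,
         distinct
      where
      f′ : V → C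
      f′ z = recolour (f x) (f y) (f z)
      keep? = λ c → ¬? (c ≟ᶜ f y)
      cs′ = filter keep? cs
      still-attained : ∀ cs → All (Attained f) cs → All (Attained f′) (filter keep? cs)
      still-attained cs attained = All.zipWith
        (λ { (c≢fy , z , pz , refl) → z , pz , recolour-≢ (f x) (f y) c≢fy })
        (All.all-filter keep? cs , All.filter⁺ keep? attained)

  Linked-constant : ∀ {A C : Set} {R : A → A → Set} (g : A → C) → (∀ {x y} → R x y → g x ≡ g y) →
                    ∀ {u v} xs → Linked R (u ∷ xs ++ [ v ]) → g u ≡ g v
  Linked-constant g const []       (r ∷ _) = const r
  Linked-constant g const (x ∷ xs) (r ∷ l) = trans (const r) (Linked-constant g const xs l)

  -- Contracts all vertices except 2, …, 12 to one.
  colour : ℕ → ℕ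
  colour v = if does ((2 ℕ.≤? v) ×-dec (v ℕ.≤? 12)) then v else 0

  colours : List ℕ
  colours = 0 ∷ applyUpTo (2 +_) 11

  colours-attained : All (Attained ℕ._≟_ (_< 14) colour) colours
  colours-attained = All.map (λ {c} (c<14 , eq) → c , c<14 , eq)
    (toWitness {a? = All.all? (λ c → (c ℕ.<? 14) ×-dec (colour c ℕ.≟ c)) colours} _)

  colours-unique : Unique colours
  colours-unique = toWitness {a? = unique? colours} _
    where open import Data.List.Relation.Unary.Unique.DecPropositional ℕ._≟_ using (unique?)

  pair-members : ∀ {e f : ℕ × ℕ} ps → (e , f) ∈ ps → let es = concatMap (λ (e , f) → e ∷ f ∷ []) ps in e ∈ es × f ∈ es
  pair-members (_ ∷ ps) (here refl) = here refl , there (here refl)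
  pair-members (_ ∷ ps) (there p)   = let e , f = pair-members ps p in there (there e) , there (there f)

  gadget-pair : ∀ {e : ℕ × ℕ} ps → e ∈ concatMap (λ (e , f) → e ∷ f ∷ []) ps →
                ∃[ f ] ((e , f) ∈ ps ⊎ (f , e) ∈ ps)
  gadget-pair ((e , f) ∷ ps) (here refl)         = f , inj₁ (here refl)
  gadget-pair ((e , f) ∷ ps) (there (here refl)) = e , inj₂ (here refl)
  gadget-pair (_ ∷ ps) (there (there e∈))        = let f , p = gadget-pair ps e∈ in f , Sum.map there there p

  module _ {n : ℕ} (15≤n : 15 ≤ n) (F : Graph n) (F⊆ : F ⊆ᵍ hubGraph n) (plane : IsPlane F (hubGraph n) F⊆ straight)
           (connected : Connected F) where
    private
      instance
        n≢0 : ℕ.NonZero n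
        n≢0 = ℕ.>-nonZero (ℕ.<-≤-trans (s≤s z≤n) 15≤n)

      -- Reduction modulo n is only a default that makes the map total; it is inverse to `toℕ` below
      -- n.
      fin : ℕ → Fin n
      fin m = m mod n

      toℕ-fin : ∀ {m} → m < n → toℕ (fin m) ≡ m
      toℕ-fin m<n = trans (Fin.toℕ-fromℕ< _) (m<n⇒m%n≡m m<n)

      fin-toℕ : ∀ u → fin (toℕ u) ≡ u
      fin-toℕ u = Fin.toℕ-injective (toℕ-fin (Fin.toℕ<n u))

      InF : ℕ × ℕ → Bool
      InF (u , v) = Graph.adj F (fin u) (fin v)

      select : (ℕ × ℕ) × (ℕ × ℕ) → ℕ × ℕ
      select (e , f) = if InF e then e else f

      fin-edge : ∀ {u v} → (u , v) ∈ gadgetEdges → T (InF (u , v)) → Edge F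
      fin-edge {u} {v} e∈ uv = edge (fin u) (fin v)
        (subst₂ _<_ (sym (toℕ-fin (ℕ.<-trans u<v v<n))) (sym (toℕ-fin v<n)) u<v) uv
        where
        u<v = proj₁ (All.lookup gadget-bounds e∈)
        v<n = ℕ.<-trans (proj₂ (All.lookup gadget-bounds e∈)) 15≤n

      exclusive : ∀ {e f : ℕ × ℕ} → (e , f) ∈ crossingPairs → T (InF e) → ¬ T (InF f)
      exclusive p e f = let e∈ , f∈ = pair-members crossingPairs p in
        plane (fin-edge e∈ e) (fin-edge f∈ f)
          (crossed⇒crosses (include F (hubGraph n) F⊆ (fin-edge e∈ e)) (include F (hubGraph n) F⊆ (fin-edge f∈ f))
            (subst₂ Crossed (sym (fin-ends e∈)) (sym (fin-ends f∈)) (∈-++⁺ˡ p)))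
        where
        fin-ends : ∀ {u v} → (u , v) ∈ gadgetEdges → (toℕ (fin u) , toℕ (fin v)) ≡ (u , v)
        fin-ends e∈ = let u<v , v<14 = All.lookup gadget-bounds e∈
                          v<n = ℕ.<-trans v<14 15≤n
                      in cong₂ _,_ (toℕ-fin (ℕ.<-trans u<v v<n)) (toℕ-fin v<n)

      select-first : ∀ e f → T (InF e) → select (e , f) ≡ e
      select-first e f t with InF e
      ... | true = refl

      select-second : ∀ e f → ¬ T (InF e) → select (e , f) ≡ f
      select-second e f ¬t with InF e
      ... | true  = contradiction _ ¬t
      ... | false = refl

      Coarsening : (ℕ → ℕ) → Set
      Coarsening g = ∀ x y → colour x ≡ colour y → g x ≡ g y

      Merged : (ℕ → ℕ) → List (ℕ × ℕ) → Set
      Merged g = All (λ (x , y) → g x ≡ g y)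

      module _ (g : ℕ → ℕ) (coarser : Coarsening g) (merged : Merged g (map select crossingPairs)) where

        selected-constant : ∀ {p e} → p ∈ crossingPairs → select p ≡ e → g (proj₁ e) ≡ g (proj₂ e)
        selected-constant p∈ refl = All.lookup merged (∈-map⁺ select p∈)

        pair-constant : ∀ {e} → T (InF e) → ∃[ f ] ((e , f) ∈ crossingPairs ⊎ (f , e) ∈ crossingPairs) →
                        g (proj₁ e) ≡ g (proj₂ e)
        pair-constant {e} t (f , inj₁ p) = selected-constant p (select-first e f t)
        pair-constant {e} t (f , inj₂ p) = selected-constant p (select-second f e λ t′ → exclusive p t′ t)

        link-constant : ∀ {u v} → Link u v → T (InF (u , v)) → g u ≡ g v
        link-constant (gadget e∈) t = pair-constant t (gadget-pair crossingPairs e∈)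
        -- Both ends of a spoke or rim edge have colour 0, which `g` cannot separate.
        link-constant (spoke₀ k) _ = coarser 0 (13 + k) refl
        link-constant (spoke₁ k) _ = coarser 1 (13 + k) refl
        link-constant (rim k)    _ = coarser (13 + k) (14 + k) refl

        joined-constant : ∀ {u v} → Joined u v → T (InF (u , v)) → g u ≡ g v
        joined-constant (inj₁ l) t = link-constant l t
        joined-constant {u} {v} (inj₂ l) t = sym (link-constant l (subst T (Graph.adj-sym F (fin u) (fin v)) t))

        adjacent-constant : ∀ {u v} → Adj F u v → g (toℕ u) ≡ g (toℕ v)
        adjacent-constant {u} {v} uv = joined-constant (T-does⁻ (joined? (toℕ u) (toℕ v)) (F⊆ u v uv))
          (subst₂ (Adj F) (sym (fin-toℕ u)) (sym (fin-toℕ v)) uv)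

        -- `Connected` yields paths only between distinct vertices, and the assumption g x ≢ g y is
        -- what makes them distinct; hence the doubly negated form.
        constant : ∀ {x y} → x < n → y < n → ¬ (g x ≢ g y)
        constant {x} {y} x<n y<n gx≢gy = gx≢gy
          (subst₂ (λ a b → g a ≡ g b) (toℕ-fin x<n) (toℕ-fin y<n)
            (Linked-constant (λ u → g (toℕ u)) adjacent-constant (internal path) (Path.linked path)))
          where
          path : Path F (fin x) (fin y)
          path = connected (fin x) (fin y) λ eq →
            gx≢gy (cong g (trans (sym (toℕ-fin x<n)) (trans (cong toℕ eq) (toℕ-fin y<n))))

      refute : Σ[ g ∈ (ℕ → ℕ) ] (Coarsening g × Merged g (map select crossingPairs) ×
                                 Σ[ x ∈ ℕ ] Σ[ y ∈ ℕ ] (x < 14 × y < 14 × g x ≢ g y)) → ⊥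
      refute (g , coarser , merged , x , y , x<14 , y<14 , gx≢gy) =
        constant g coarser merged (ℕ.<-trans x<14 15≤n) (ℕ.<-trans y<14 15≤n) gx≢gy

    disconnected : ⊥
    disconnected = refute (colour-merging ℕ._≟_ (_< 14) (map select crossingPairs) colour colours
      -- Ten selected edges against twelve colours: 2 + 10 ≤ 12 holds with equality.
      ℕ.≤-refl colours-unique colours-attained)

open Graphs using (hubGraph; hubGraph-3-connected)
open Drawings using (straight; straight-1-plane)
open Obstruction using (disconnected)

hubGraphs : ℕ → OnePlaneGraph
hubGraphs i = record { order = 15 ℕ.+ i ; graph = hubGraph (15 ℕ.+ i) ; drawing = straight ; 1-plane = straight-1-plane }

theorem2 : Σ[ G ∈ (ℕ → OnePlaneGraph) ]
    ((∀ i j → i ≢ j → ¬ Isomorphic (graph (G i)) (graph (G j))) ×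
    (∀ i → KConnected 3 (graph (G i)) ×
    ¬ HasConnectedSpanningPlaneSubgraph (G i)))
theorem2 = hubGraphs ,
  -- Already the orders 15 + i are pairwise different.
  (λ i j i≢j (φ , _) → i≢j (ℕ.+-cancelˡ-≡ 15 i j (↔⇒≡ φ))) ,
  λ i → hubGraph-3-connected (ℕ.m≤m+n 15 i) ,
    λ (F , F⊆ , plane , connected) → disconnected (ℕ.m≤m+n 15 i) F F⊆ plane connected
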